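{- Let $N\ge6$ and let $\gamma=\mathsf{432165}+\mathsf{432615}+\mathsf{426315}+\mathsf{264315}+\mathsf{264153}+\mathsf{261543}+\mathsf{216543}+\mathsf{426351}+\mathsf{624153}+\mathsf{425631}+\mathsf{462351}+\mathsf{624513}+\mathsf{641253}+\mathsf{452631}+\mathsf{462513}+\mathsf{641523}+\mathsf{456231}+\mathsf{456213}+\mathsf{465123}+\mathsf{645123}\in\mathcal U^*_{\ge0}$. Then (i) $\gamma\in I_{\mathrm S}^\perp$ and $F_\gamma=s_{321}+s_{2211}-s_{222}$, which is not Schur positive; (ii) for $\lambda=(2,2,2)$, $\mathfrak J_\lambda(\mathbf u)$ is not $\mathbb Q$-monomial positive modulo $I_{\mathrm S}$ (and hence not modulo $I_{\mathrm C}$). In particular the equivalent conditions "all $F_\gamma$ with $\gamma\in\mathcal U^*_{\ge0}\cap I^\perp$ are Schur positive" and "all $\mathfrak J_\lambda(\mathbf u)$ are $\mathbb Q$-monomial positive modulo $I$" fail for $I=I_{\mathrm S}$ and $I=I_{\mathrm C}$.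
   Context: $\mathcal U=\mathbb Z\langle u_1,\dots,u_N\rangle$ the free associative ring; $\mathbf u_{\mathsf w}=u_{\mathsf w_1}\cdots u_{\mathsf w_n}$. $e_k(\mathbf u)=\sum_{N\ge i_1>\cdots>i_k\ge1}u_{i_1}\cdots u_{i_k}$, $e_0=1$, $e_k=0$ for $k<0$ or $k>N$. For a partition $\lambda$ with conjugate $\lambda'$, $t=\lambda_1$, $\mathfrak J_\lambda(\mathbf u)=\sum_{\pi\in S_t}\mathrm{sgn}(\pi)\prod_{i=1}^te_{\lambda'_i+\pi(i)-i}(\mathbf u)$. $I_{\mathrm C}$ is the two-sided ideal generated by $u_b^2u_a+u_au_bu_a-u_bu_au_b-u_bu_a^2$ ($a<b$); $u_bu_cu_a+u_au_cu_b-u_bu_au_c-u_cu_au_b$ ($a<b<c$); $u_cu_bu_cu_a+u_bu_cu_au_c-u_cu_bu_au_c-u_bu_c^2u_a$ ($a<b<c$). $I_{\mathrm S}$ is the two-sided ideal generated by $u_b^2u_a+u_au_bu_a-u_bu_au_b-u_bu_a^2$ ($b-a=1$); $u_b^2u_a-u_bu_au_b$ ($b-a\ge2$); $u_bu_a^2-u_au_bu_a$ ($b-a\ge2$); $u_bu_cu_a+u_au_cu_b-u_bu_au_c-u_cu_au_b$ ($a<b<c$). $\mathcal U^*$ is the free $\mathbb Z$-module on words, paired by $\langle\mathbf u_{\mathsf w},\mathsf v\rangle=\delta_{\mathsf v\mathsf w}$; $I^\perp=\{\gamma:\langle z,\gamma\rangle=0\ \forall z\in I\}$; $\mathcal U^*_{\ge0}$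 = nonnegative integer combinations of words. $F_\gamma(\mathbf x)=\sum\gamma_{\mathsf w}Q_{\mathrm{Des}(\mathsf w)}(\mathbf x)$ with $\mathrm{Des}(\mathsf w)=\{i:\mathsf w_i>\mathsf w_{i+1}\}$, $Q_D(\mathbf x)=\sum x_{i_1}\cdots x_{i_n}$ over $1\le i_1\le\cdots\le i_n$ with $i_j<i_{j+1}$ for $j\in D$. $f$ is $\mathbb Q$-monomial positive modulo $I$ if some positive integer multiple of $f$ is congruent mod $I$ to a nonnegative integer combination of monomials. -}

module Defs where

open import Data.Nat as ℕ using (ℕ; zero; suc; _≤_; _<_; _≤ᵇ_; _<ᵇ_; _≡ᵇ_; _∸_; _⊔_)
open import Data.Integer as ℤ using (ℤ; +_; -[1+_])
open import Data.Bool using (Bool; true; false; _∧_; if_then_else_)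
open import Data.List using (List; []; _∷_; _++_; map; concatMap; length; foldr; filterᵇ; upTo; concat; zipWith)
open import Data.List.Relation.Unary.All using (All)
open import Data.List.Relation.Unary.Linked using (Linked)
open import Data.Product using (Σ; _×_; _,_; proj₁; proj₂)
open import Relation.Binary.PropositionalEquality using (_≡_)
open import Relation.Nullary using (¬_)

Word : Set
Word = List ℕ

-- a formal ℤ-linear combination of words; used for 𝒰 = ℤ⟨u₁,…,u_N⟩
-- (word w ↦ 𝐮_w) and for 𝒰* (word w ↦ the basis element w)
Poly : Set
Poly = List (ℤ × Word)

allᵇ : {A : Set} → (A → Bool) → List A → Bool
allᵇ p = foldr (λ x b → p x ∧ b) true

sumℤ : List ℤ → ℤ
sumℤ = foldr ℤ._+_ (+ 0)

wordEq : Word → Word → Bool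
wordEq []       []       = true
wordEq (a ∷ as) (b ∷ bs) = (a ≡ᵇ b) ∧ wordEq as bs
wordEq _        _        = false

coeff : Poly → Word → ℤ
coeff p w = sumℤ (map (λ { (c , v) → if wordEq v w then c else + 0 }) p)

_≈ᵤ_ : Poly → Poly → Set
p ≈ᵤ q = ∀ w → coeff p w ≡ coeff q w

one : Poly
one = (+ 1 , []) ∷ []

scale : ℤ → Poly → Poly
scale c = map (λ { (d , w) → (c ℤ.* d , w) })

_*ᵤ_ : Poly → Poly → Poly
p *ᵤ q = concatMap (λ { (c , w) → map (λ { (d , v) → (c ℤ.* d , w ++ v) }) q }) p

-- all letters of all words lie in {1,…,N}, i.e. the element lies in 𝒰 = ℤ⟨u₁,…,u_N⟩
InAlphabet : ℕ → Poly → Set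
InAlphabet N p = All (λ cw → All (λ x → (1 ≤ x) × (x ≤ N)) (proj₂ cw)) p

-- nonnegative integer combination of words (𝒰*_{≥0}, resp. monomial positive)
NonNeg : Poly → Set
NonNeg p = All (λ cw → + 0 ℤ.≤ proj₁ cw) p

relA : ℕ → ℕ → Poly
relA a b = (+ 1 , b ∷ b ∷ a ∷ []) ∷ (+ 1 , a ∷ b ∷ a ∷ []) ∷ (ℤ.- + 1 , b ∷ a ∷ b ∷ []) ∷ (ℤ.- + 1 , b ∷ a ∷ a ∷ []) ∷ []

relB : ℕ → ℕ → ℕ → Poly
relB a b c = (+ 1 , b ∷ c ∷ a ∷ []) ∷ (+ 1 , a ∷ c ∷ b ∷ []) ∷ (ℤ.- + 1 , b ∷ a ∷ c ∷ []) ∷ (ℤ.- + 1 , c ∷ a ∷ b ∷ []) ∷ []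

relC : ℕ → ℕ → ℕ → Poly
relC a b c = (+ 1 , c ∷ b ∷ c ∷ a ∷ []) ∷ (+ 1 , b ∷ c ∷ a ∷ c ∷ []) ∷ (ℤ.- + 1 , c ∷ b ∷ a ∷ c ∷ []) ∷ (ℤ.- + 1 , b ∷ c ∷ c ∷ a ∷ []) ∷ []

relS2 : ℕ → ℕ → Poly
relS2 a b = (+ 1 , b ∷ b ∷ a ∷ []) ∷ (ℤ.- + 1 , b ∷ a ∷ b ∷ []) ∷ []

relS3 : ℕ → ℕ → Poly
relS3 a b = (+ 1 , b ∷ a ∷ a ∷ []) ∷ (ℤ.- + 1 , a ∷ b ∷ a ∷ []) ∷ []

data GenC (N : ℕ) : Poly → Set where
  cA : ∀ {a b} → 1 ≤ a → a < b → b ≤ N → GenC N (relA a b)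
  cB : ∀ {a b c} → 1 ≤ a → a < b → b < c → c ≤ N → GenC N (relB a b c)
  cC : ∀ {a b c} → 1 ≤ a → a < b → b < c → c ≤ N → GenC N (relC a b c)

data GenS (N : ℕ) : Poly → Set where
  sA : ∀ {a b} → 1 ≤ a → b ≡ suc a → b ≤ N → GenS N (relA a b)
  sB : ∀ {a b} → 1 ≤ a → 2 ℕ.+ a ≤ b → b ≤ N → GenS N (relS2 a b)
  sC : ∀ {a b} → 1 ≤ a → 2 ℕ.+ a ≤ b → b ≤ N → GenS N (relS3 a b)
  sD : ∀ {a b c} → 1 ≤ a → a < b → b < c → c ≤ N → GenS N (relB a b c)

InIdeal : ℕ → (Poly → Set) → Poly → Set
InIdeal N Gen z =
  Σ (List (Poly × Poly × Poly)) λ ts →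
    All (λ { (x , r , y) → InAlphabet N x × Gen r × InAlphabet N y }) ts ×
    (z ≈ᵤ concatMap (λ { (x , r , y) → (x *ᵤ r) *ᵤ y }) ts)

pair : Poly → Poly → ℤ
pair z γ = sumℤ (map (λ { (c , w) → c ℤ.* coeff γ w }) z)

Perp : ℕ → (Poly → Set) → Poly → Set
Perp N Gen γ = ∀ z → InIdeal N Gen z → pair z γ ≡ + 0

-- Formal power series in x₁, x₂, … given by coefficients of monomials
-- x_{i₁}⋯x_{iₙ}, a monomial being encoded by its weakly increasing index
-- list 1 ≤ i₁ ≤ ⋯ ≤ iₙ (only such lists are compared).

Series : Set
Series = List ℕ → ℤ

_≈ₛ_ : Series → Series → Set
f ≈ₛ g = ∀ i → Linked _≤_ i → All (λ x → 1 ≤ x) i → f i ≡ g i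

_+ₛ_ : Series → Series → Series
(f +ₛ g) i = f i ℤ.+ g i

_-ₛ_ : Series → Series → Series
(f -ₛ g) i = f i ℤ.- g i

-- 1-based lookup (default 0)
at : List ℕ → ℕ → ℕ
at []       _             = 0
at (x ∷ xs) zero          = 0
at (x ∷ xs) (suc zero)    = x
at (x ∷ xs) (suc (suc j)) = at xs (suc j)

desAux : ℕ → Word → List ℕ
desAux k (a ∷ b ∷ w) = if b <ᵇ a then k ∷ desAux (suc k) (b ∷ w) else desAux (suc k) (b ∷ w)
desAux k _           = []

Des : Word → List ℕ
Des = desAux 1

Q : ℕ → List ℕ → Series
Q n D i = if (length i ≡ᵇ n) ∧ allᵇ (λ j → at i j <ᵇ at i (suc j)) D then + 1 else + 0

F : Poly → Series
F γ i = sumℤ (map (λ { (c , w) → c ℤ.* Q (length w) (Des w) i }) γ)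

IsPartition : List ℕ → Set
IsPartition λ′ = Linked (λ a b → b ≤ a) λ′ × All (λ x → 1 ≤ x) λ′

vecs : ℕ → List ℕ → List (List ℕ)
vecs zero    vs = [] ∷ []
vecs (suc k) vs = concatMap (λ v → map (v ∷_) (vecs k vs)) vs

-- all fillings (given as lists of rows) of the diagram with row lengths sh
fillings : List ℕ → List ℕ → List (List (List ℕ))
fillings []       vs = [] ∷ []
fillings (l ∷ ls) vs = concatMap (λ r → map (r ∷_) (fillings ls vs)) (vecs l vs)

rowWeak : List ℕ → Bool
rowWeak (a ∷ b ∷ r) = (a ≤ᵇ b) ∧ rowWeak (b ∷ r)
rowWeak _           = true

colStrict : List ℕ → List ℕ → Bool
colStrict (a ∷ as) (b ∷ bs) = (a <ᵇ b) ∧ colStrict as bs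
colStrict _        _        = true

colsStrict : List (List ℕ) → Bool
colsStrict (r ∷ s ∷ rs) = colStrict r s ∧ colsStrict (s ∷ rs)
colsStrict _            = true

isSSYT : List (List ℕ) → Bool
isSSYT T = allᵇ rowWeak T ∧ colsStrict T

countᵇ : ℕ → List ℕ → ℕ
countᵇ v xs = length (filterᵇ (v ≡ᵇ_) xs)

sameContent : List ℕ → List ℕ → Bool
sameContent xs ys = allᵇ (λ v → countᵇ v xs ≡ᵇ countᵇ v ys) (xs ++ ys)

maxℕ : List ℕ → ℕ
maxℕ = foldr _⊔_ 0

schur : List ℕ → Series
schur sh i = + length (filterᵇ (λ T → isSSYT T ∧ sameContent (concat T) i) (fillings sh (upTo (suc (maxℕ i)))))

SchurPositive : Series → Set
SchurPositive f =
  Σ (List (List ℕ)) λ L → All IsPartition L ×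
    (f ≈ₛ (λ i → sumℤ (map (λ μ → schur μ i) L)))

decWords : ℕ → ℕ → List Word
decWords zero    m = [] ∷ []
decWords (suc k) m = concatMap (λ a → map (a ∷_) (decWords k (a ∸ 1))) (map suc (upTo m))

-- e_k(𝐮) in ℤ⟨u₁,…,u_N⟩  (0 for k < 0 or k > N)
e : ℕ → ℤ → Poly
e N (+ k)    = map (λ w → (+ 1 , w)) (decWords k N)
e N -[1+ _ ] = []

insertions : ℕ → List ℕ → List (List ℕ)
insertions x []       = (x ∷ []) ∷ []
insertions x (y ∷ ys) = (x ∷ y ∷ ys) ∷ map (y ∷_) (insertions x ys)

perms : List ℕ → List (List ℕ)
perms []       = [] ∷ []
perms (x ∷ xs) = concatMap (insertions x) (perms xs)

inversions : List ℕ → ℕ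
inversions []       = 0
inversions (x ∷ xs) = length (filterᵇ (_<ᵇ x) xs) ℕ.+ inversions xs

even : ℕ → Bool
even zero          = true
even (suc zero)    = false
even (suc (suc n)) = even n

sgn : List ℕ → ℤ
sgn π = if even (inversions π) then + 1 else ℤ.- + 1

headℕ : List ℕ → ℕ
headℕ []      = 0
headℕ (x ∷ _) = x

conj : List ℕ → List ℕ
conj λ′ = map (λ i → countGE i) (map suc (upTo (headℕ λ′)))
  where countGE : ℕ → ℕ
        countGE i = length (filterᵇ (i ≤ᵇ_) λ′)

𝔍 : ℕ → List ℕ → Poly
𝔍 N λ′ = concatMap term (perms (map suc (upTo t)))
  where
    t = headℕ λ′
    lc = conj λ′
    term : List ℕ → Poly
    term π = scale (sgn π)
      (foldr _*ᵤ_ one (map (λ i → e N ((+ at lc i ℤ.+ + at π i) ℤ.- + i)) (map suc (upTo t))))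

QMonPos : ℕ → (Poly → Set) → Poly → Set
QMonPos N Gen f =
  Σ ℕ λ m → (1 ≤ m) × Σ Poly λ g → NonNeg g × InAlphabet N g ×
    InIdeal N Gen (scale (+ m) f ++ scale (ℤ.- + 1) g)

w6 : ℕ → ℕ → ℕ → ℕ → ℕ → ℕ → Word
w6 a b c d x y = a ∷ b ∷ c ∷ d ∷ x ∷ y ∷ []

γ₀ : Poly
γ₀ = map (λ w → (+ 1 , w))
  ( w6 4 3 2 1 6 5 ∷ w6 4 3 2 6 1 5 ∷ w6 4 2 6 3 1 5 ∷ w6 2 6 4 3 1 5 ∷ w6 2 6 4 1 5 3
  ∷ w6 2 6 1 5 4 3 ∷ w6 2 1 6 5 4 3 ∷ w6 4 2 6 3 5 1 ∷ w6 6 2 4 1 5 3 ∷ w6 4 2 5 6 3 1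
  ∷ w6 4 6 2 3 5 1 ∷ w6 6 2 4 5 1 3 ∷ w6 6 4 1 2 5 3 ∷ w6 4 5 2 6 3 1 ∷ w6 4 6 2 5 1 3
  ∷ w6 6 4 1 5 2 3 ∷ w6 4 5 6 2 3 1 ∷ w6 4 5 6 2 1 3 ∷ w6 4 6 5 1 2 3 ∷ w6 6 4 5 1 2 3 ∷ [])

-- Every word of γ₀ has letters in 1..6, so γ₀ annihilates a generator of I_S or I_C in
-- a context x _ y unless all its letters are ≤ 6 and (x , y) is cut out of a word of γ₀;
-- the finitely many remaining cases are checked by computation.  A nonnegative γ ∈ I^⊥
-- pairs to 0 with m f − g ∈ I, so f cannot be ℚ-monomial positive if ⟨f , γ⟩ < 0; and
-- ⟨𝔍₂₂₂ , γ₀⟩ = −1 because the words of e_k(u₁,…,u_N) that are not words of e_k(u₁,…,u₆)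
-- contain a letter > 6.  F γ₀ and every s_λ take the same value on monomials related by
-- an order-preserving relabelling of the variables, so the expansion of F γ₀ need only
-- be checked on the 32 standard monomials of degree 6.  Finally the linear functional
-- 2[x³²¹] − [x²²²] − 10([x³³] + [x⁴²] + [x⁴¹¹]) is ≤ 0 on every Schur function but is 1
-- on F γ₀.

module Submission where

open import Defs
open import Data.Bool using (Bool; true; false; _∧_; if_then_else_; T)
open import Data.Bool.Properties using (T-∧)
open import Data.Empty using (⊥-elim)
open import Data.Integer as ℤ using (ℤ; +_; -[1+_]; +≤+)
import Data.Integer.Properties as ℤP
open import Data.Integer.Solver using (module +-*-Solver)
open import Data.List using (List; []; _∷_; _++_; map; concatMap; length; concat; filterᵇ; upTo; take; drop)
import Data.List.Properties as LP
open import Data.List.Membership.Propositional using (_∈_; _∉_; lose)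
open import Data.List.Membership.Propositional.Properties
  using (∈-map⁺; ∈-map⁻; ∈-concatMap⁺; ∈-concatMap⁻; ∈-upTo⁺; ∈-++⁺ˡ; ∈-++⁺ʳ; ∈-filter⁺; ∈-filter⁻; ∈-concat⁺′; ∈-∃++)
open import Data.List.Relation.Unary.All as All using (All; []; _∷_; all?)
import Data.List.Relation.Unary.All.Properties as AllP
open import Data.List.Relation.Unary.Any as Any using (Any; here; there)
import Data.List.Relation.Unary.Any.Properties as AnyP
open import Data.List.Relation.Unary.Linked as Linked using (Linked; []; [-]; _∷_; linked?)
import Data.List.Relation.Unary.Linked.Properties as LinkedP
open import Data.Nat as ℕ using (ℕ; zero; suc; _+_; _∸_; _≤_; _<_; z≤n; s≤s; z<s; _≡ᵇ_; _<ᵇ_; _≤ᵇ_)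
open import Data.Nat.ListAction using (sum)
import Data.Nat.Properties as ℕP
open import Data.List.Membership.DecPropositional ℕP._≟_ using (_∈?_)
open import Data.Product using (Σ; ∃-syntax; _×_; _,_; proj₁; proj₂)
import Data.Product.Properties as ×P
open import Data.Sum using (inj₁; inj₂)
open import Data.Unit using (tt)
open import Function using (_∘_; Equivalence)
open import Relation.Binary using (tri<; tri≈; tri>)
open import Relation.Binary.PropositionalEquality
open import Relation.Nullary using (Dec; yes; no; ¬_)
open import Relation.Nullary.Decidable using (T?; isYes; toWitness; fromWitness; from-yes; _×-dec_; _→-dec_)
open import Data.List.Membership.DecPropositional (×P.≡-dec (LP.≡-dec ℕP._≟_) (LP.≡-dec ℕP._≟_))
  using () renaming (_∈?_ to _∈²?_)

private
  variable
    A B : Set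

-- The linear functional 𝐮_w ↦ h w on 𝒰; pair z γ is eval (coeff γ) z.
eval : (Word → ℤ) → Poly → ℤ
eval h p = sumℤ (map (λ cw → proj₁ cw ℤ.* h (proj₂ cw)) p)

eval-++ : ∀ h p q → eval h (p ++ q) ≡ eval h p ℤ.+ eval h q
eval-++ h []            q = sym (ℤP.+-identityˡ _)
eval-++ h ((c , w) ∷ p) q rewrite eval-++ h p q = sym (ℤP.+-assoc (c ℤ.* h w) _ _)

eval-cong : ∀ {h h′} p → (∀ w → h w ≡ h′ w) → eval h p ≡ eval h′ p
eval-cong []            h≗h′ = refl
eval-cong ((c , w) ∷ p) h≗h′ = cong₂ (λ a b → c ℤ.* a ℤ.+ b) (h≗h′ w) (eval-cong p h≗h′)

eval-zero : ∀ {h} p → (∀ w → h w ≡ + 0) → eval h p ≡ + 0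
eval-zero p h≗0 = trans (eval-cong p h≗0) (go p)
  where
    go : ∀ p → eval (λ _ → + 0) p ≡ + 0
    go []            = refl
    go ((c , _) ∷ p) rewrite go p | ℤP.*-zeroʳ c = refl

eval-zero-on : ∀ {h} p → All (λ cw → h (proj₂ cw) ≡ + 0) p → eval h p ≡ + 0
eval-zero-on []            []          = refl
eval-zero-on ((c , w) ∷ p) (hw≡0 ∷ hs) rewrite hw≡0 | eval-zero-on p hs | ℤP.*-zeroʳ c = refl

eval-+ : ∀ h h′ p → eval (λ w → h w ℤ.+ h′ w) p ≡ eval h p ℤ.+ eval h′ p
eval-+ h h′ []            = refl
eval-+ h h′ ((c , w) ∷ p) rewrite eval-+ h h′ p =
  solve 5 (λ c a b x y → c :* (a :+ b) :+ (x :+ y) := (c :* a :+ x) :+ (c :* b :+ y))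
    refl c (h w) (h′ w) (eval h p) (eval h′ p)
  where open +-*-Solver

eval-scaleʳ : ∀ c h p → c ℤ.* eval h p ≡ eval (λ w → c ℤ.* h w) p
eval-scaleʳ c h []            = ℤP.*-zeroʳ c
eval-scaleʳ c h ((d , w) ∷ p) rewrite sym (eval-scaleʳ c h p) =
  solve 4 (λ c d a x → c :* (d :* a :+ x) := d :* (c :* a) :+ c :* x) refl c d (h w) (eval h p)
  where open +-*-Solver

eval-scale : ∀ h c p → eval h (scale c p) ≡ c ℤ.* eval h p
eval-scale h c []            = sym (ℤP.*-zeroʳ c)
eval-scale h c ((d , w) ∷ p) =
  trans (cong₂ ℤ._+_ (ℤP.*-assoc c d (h w)) (eval-scale h c p))
        (sym (ℤP.*-distribˡ-+ c (d ℤ.* h w) (eval h p)))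

eval-swap : ∀ (K : Word → Word → ℤ) p q →
            eval (λ w → eval (K w) q) p ≡ eval (λ v → eval (λ w → K w v) p) q
eval-swap K []            q = sym (eval-zero q (λ _ → refl))
eval-swap K ((c , w) ∷ p) q = begin
    c ℤ.* eval (K w) q ℤ.+ eval (λ w → eval (K w) q) p
  ≡⟨ cong₂ ℤ._+_ (eval-scaleʳ c (K w) q) (eval-swap K p q) ⟩
    eval (λ v → c ℤ.* K w v) q ℤ.+ eval (λ v → eval (λ w → K w v) p) q
  ≡⟨ eval-+ (λ v → c ℤ.* K w v) (λ v → eval (λ w → K w v) p) q ⟨
    eval (λ v → c ℤ.* K w v ℤ.+ eval (λ w → K w v) p) q
  ∎ where open ≡-Reasoning

eval-prefix : ∀ h c w q →
  eval h (map (λ { (d , v) → (c ℤ.* d , w ++ v) }) q) ≡ c ℤ.* eval (λ v → h (w ++ v)) q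
eval-prefix h c w [] = sym (ℤP.*-zeroʳ c)
eval-prefix h c w ((d , v) ∷ q) =
  trans (cong (ℤ._+_ (c ℤ.* d ℤ.* h (w ++ v))) (eval-prefix h c w q))
        (solve 4 (λ c d a x → c :* d :* a :+ c :* x := c :* (d :* a :+ x)) refl
           c d (h (w ++ v)) (eval (λ v → h (w ++ v)) q))
  where open +-*-Solver

eval-*ᵤ : ∀ h p q → eval h (p *ᵤ q) ≡ eval (λ w → eval (λ v → h (w ++ v)) q) p
eval-*ᵤ h []            q = refl
eval-*ᵤ h ((c , w) ∷ p) q =
  trans (eval-++ h (map (λ { (d , v) → (c ℤ.* d , w ++ v) }) q) (p *ᵤ q))
        (cong₂ ℤ._+_ (eval-prefix h c w q) (eval-*ᵤ h p q))

≡ᵇ-sym : ∀ a b → (a ≡ᵇ b) ≡ (b ≡ᵇ a)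
≡ᵇ-sym zero    zero    = refl
≡ᵇ-sym zero    (suc _) = refl
≡ᵇ-sym (suc _) zero    = refl
≡ᵇ-sym (suc a) (suc b) = ≡ᵇ-sym a b

wordEq-sym : ∀ u v → wordEq u v ≡ wordEq v u
wordEq-sym []      []      = refl
wordEq-sym []      (_ ∷ _) = refl
wordEq-sym (_ ∷ _) []      = refl
wordEq-sym (a ∷ u) (b ∷ v) = cong₂ _∧_ (≡ᵇ-sym a b) (wordEq-sym u v)

δ : Word → Word → ℤ
δ u v = if wordEq u v then + 1 else + 0

coeff-as-eval : ∀ γ w → coeff γ w ≡ eval (λ v → δ v w) γ
coeff-as-eval []            w = refl
coeff-as-eval ((d , v) ∷ γ) w with wordEq v w
... | true  = cong₂ ℤ._+_ (sym (ℤP.*-identityʳ d)) (coeff-as-eval γ w)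
... | false = cong₂ ℤ._+_ (sym (ℤP.*-zeroʳ d)) (coeff-as-eval γ w)

pair-comm : ∀ z γ → pair z γ ≡ pair γ z
pair-comm z γ = begin
    eval (coeff γ) z
  ≡⟨ eval-cong z (coeff-as-eval γ) ⟩
    eval (λ w → eval (λ v → δ v w) γ) z
  ≡⟨ eval-swap (λ w v → δ v w) z γ ⟩
    eval (λ v → eval (λ w → δ v w) z) γ
  ≡⟨ eval-cong γ (λ v → eval-cong z (λ w → cong (if_then + 1 else + 0) (wordEq-sym v w))) ⟩
    eval (λ v → eval (λ w → δ w v) z) γ
  ≡⟨ eval-cong γ (coeff-as-eval z) ⟨
    eval (coeff z) γ
  ∎ where open ≡-Reasoning

pair-congˡ : ∀ z z′ γ → z ≈ᵤ z′ → pair z γ ≡ pair z′ γ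
pair-congˡ z z′ γ z≈z′ =
  trans (pair-comm z γ) (trans (eval-cong γ z≈z′) (sym (pair-comm z′ γ)))

Annihilates : Poly → Poly → Set
Annihilates γ r = ∀ x y → eval (λ w → coeff γ ((x ++ w) ++ y)) r ≡ + 0

pair-sandwich : ∀ γ x r y → Annihilates γ r → pair ((x *ᵤ r) *ᵤ y) γ ≡ + 0
pair-sandwich γ x r y ann = begin
    eval h ((x *ᵤ r) *ᵤ y)
  ≡⟨ eval-*ᵤ h (x *ᵤ r) y ⟩
    eval (λ w → eval (λ v → h (w ++ v)) y) (x *ᵤ r)
  ≡⟨ eval-*ᵤ (λ w → eval (λ v → h (w ++ v)) y) x r ⟩
    eval (λ u → eval (λ w → eval (λ v → h ((u ++ w) ++ v)) y) r) x
  ≡⟨ eval-zero x (λ u → trans (eval-swap (λ w v → h ((u ++ w) ++ v)) r y)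
                               (eval-zero y (ann u))) ⟩
    + 0
  ∎ where
    open ≡-Reasoning
    h = coeff γ

perp-from-generators : ∀ N (Gen : Poly → Set) γ → (∀ r → Gen r → Annihilates γ r) → Perp N Gen γ
perp-from-generators N Gen γ ann z (ts , gens , z≈) =
  trans (pair-congˡ z (concatMap sandwich ts) γ z≈) (go ts gens)
  where
    sandwich : Poly × Poly × Poly → Poly
    sandwich (x , r , y) = (x *ᵤ r) *ᵤ y
    go : ∀ ts → All (λ { (x , r , y) → InAlphabet N x × Gen r × InAlphabet N y }) ts →
         pair (concatMap sandwich ts) γ ≡ + 0
    go []                []                  = refl
    go ((x , r , y) ∷ ts) ((_ , gr , _) ∷ gs) =
      trans (eval-++ (coeff γ) ((x *ᵤ r) *ᵤ y) _)
            (cong₂ ℤ._+_ (pair-sandwich γ x r y (ann r gr)) (go ts gs))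

wordEq-sound : ∀ u v → wordEq u v ≡ true → u ≡ v
wordEq-sound []      []      _ = refl
wordEq-sound (a ∷ u) (b ∷ v) eq with a ℕ.≡ᵇ b in a≡ᵇb
... | true = cong₂ _∷_ (ℕP.≡ᵇ⇒≡ a b (subst T (sym a≡ᵇb) _)) (wordEq-sound u v eq)

coeff-absent : ∀ γ w → (∀ {cv} → cv ∈ γ → proj₂ cv ≢ w) → coeff γ w ≡ + 0
coeff-absent []            w absent = refl
coeff-absent ((c , v) ∷ γ) w absent with wordEq v w in v≟w
... | true  = ⊥-elim (absent (here refl) (wordEq-sound v w v≟w))
... | false = trans (ℤP.+-identityˡ _) (coeff-absent γ w (λ cv∈γ → absent (there cv∈γ)))

-- Contains every (x , y) with u = (x ++ w) ++ y and length w ≡ L.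
splittings : ℕ → Word → List (Word × Word)
splittings L u = map (λ k → take k u , drop (k + L) u) (upTo (suc (length u)))

contexts : ℕ → Poly → List (Word × Word)
contexts L γ = concatMap (λ cu → splittings L (proj₂ cu)) γ

take-length-++ : ∀ (x w y : Word) → take (length x) ((x ++ w) ++ y) ≡ x
take-length-++ []      w y = refl
take-length-++ (a ∷ x) w y = cong (a ∷_) (take-length-++ x w y)

drop-length-++ : ∀ (x w y : Word) → drop (length x + length w) ((x ++ w) ++ y) ≡ y
drop-length-++ []      []      y = refl
drop-length-++ []      (_ ∷ w) y = drop-length-++ [] w y
drop-length-++ (_ ∷ x) w       y = drop-length-++ x w y

length-prefix-≤ : ∀ (x w y : Word) → length x ≤ length ((x ++ w) ++ y)
length-prefix-≤ []      w y = z≤n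
length-prefix-≤ (_ ∷ x) w y = s≤s (length-prefix-≤ x w y)

∈-contexts : ∀ γ x w y {cu} → cu ∈ γ → proj₂ cu ≡ (x ++ w) ++ y → (x , y) ∈ contexts (length w) γ
∈-contexts γ x w y {c , .((x ++ w) ++ y)} cu∈γ refl =
  ∈-concatMap⁺ (λ cu → splittings (length w) (proj₂ cu)) (lose cu∈γ (subst (_∈ splittings (length w) u) split
    (∈-map⁺ (λ k → take k u , drop (k + length w) u) (∈-upTo⁺ (s≤s (length-prefix-≤ x w y))))))
  where
    u = (x ++ w) ++ y
    split : (take (length x) u , drop (length x + length w) u) ≡ (x , y)
    split = cong₂ _,_ (take-length-++ x w y) (drop-length-++ x w y)

AnnihilatesOn : List (Word × Word) → Poly → Poly → Set
AnnihilatesOn cs γ r = All (λ xy → eval (λ w → coeff γ ((proj₁ xy ++ w) ++ proj₂ xy)) r ≡ + 0) cs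

annihilatesOn? : ∀ cs γ r → Dec (AnnihilatesOn cs γ r)
annihilatesOn? cs γ r = all? (λ xy → _ ℤP.≟ + 0) cs

annihilates-from-contexts : ∀ γ L r → All (λ cw → length (proj₂ cw) ≡ L) r →
                            AnnihilatesOn (contexts L γ) γ r → Annihilates γ r
annihilates-from-contexts γ L r lengths checked x y with (x , y) ∈²? contexts L γ
... | yes xy∈ = All.lookup checked xy∈
... | no  xy∉ = eval-zero-on r (All.map (λ { refl → coeff-absent γ _ (λ cu∈γ eq → xy∉ (∈-contexts γ x _ y cu∈γ eq)) }) lengths)

Large : ℕ → Word → Set
Large k = Any (k <_)

VanishesAbove : ℕ → (Word → ℤ) → Set
VanishesAbove k h = ∀ w → Large k w → h w ≡ + 0

annihilates-above : ∀ {k} γ r → VanishesAbove k (coeff γ) → All (λ cw → Large k (proj₂ cw)) r → Annihilates γ r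
annihilates-above γ r vanish large x y =
  eval-zero-on r (All.map (λ w-large → vanish _ (AnyP.++⁺ˡ (AnyP.++⁺ʳ x w-large))) large)

γ₀-alphabet : InAlphabet 6 γ₀
γ₀-alphabet = from-yes (all? (λ cu → all? (λ x → (1 ℕP.≤? x) ×-dec (x ℕP.≤? 6)) (proj₂ cu)) γ₀)

coeff-γ₀-vanishesAbove6 : VanishesAbove 6 (coeff γ₀)
coeff-γ₀-vanishesAbove6 w large = coeff-absent γ₀ w λ cu∈γ₀ u≡w →
  All.lookupWith (λ letter≤6 6<letter → ℕP.<⇒≱ 6<letter (proj₂ letter≤6))
                 (All.lookup γ₀-alphabet cu∈γ₀) (subst (Large 6) (sym u≡w) large)

annihilates-γ₀ : ∀ L r t → All (λ cw → length (proj₂ cw) ≡ L) r → All (λ cw → t ∈ proj₂ cw) r →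
                 (t ≤ 6 → AnnihilatesOn (contexts L γ₀) γ₀ r) → Annihilates γ₀ r
annihilates-γ₀ L r t lengths t∈r small-case with t ℕP.≤? 6
... | yes t≤6 = annihilates-from-contexts γ₀ L r lengths (small-case t≤6)
... | no  t≰6 = annihilates-above γ₀ r coeff-γ₀-vanishesAbove6
                  (All.map (Any.map (λ { refl → ℕP.≰⇒> t≰6 })) t∈r)

small : List ℕ
small = upTo 7

ForSmall₂ : (ℕ → ℕ → Set) → Set
ForSmall₂ P = All (λ a → All (P a) small) small

ForSmall₃ : (ℕ → ℕ → ℕ → Set) → Set
ForSmall₃ P = All (λ a → ForSmall₂ (P a)) small

forSmall₂ : ∀ {P a b} → ForSmall₂ P → a < b → b ≤ 6 → P a b
forSmall₂ all a<b b≤6 =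
  All.lookup (All.lookup all (∈-upTo⁺ (s≤s (ℕP.≤-trans (ℕP.<⇒≤ a<b) b≤6)))) (∈-upTo⁺ (s≤s b≤6))

forSmall₃ : ∀ {P a b c} → ForSmall₃ P → a < b → b < c → c ≤ 6 → P a b c
forSmall₃ all a<b b<c c≤6 =
  forSmall₂ (All.lookup all (∈-upTo⁺ (s≤s (ℕP.≤-trans (ℕP.<⇒≤ (ℕP.<-trans a<b b<c)) c≤6)))) b<c c≤6

Checked₂ : ℕ → (ℕ → ℕ → Set) → (ℕ → ℕ → Poly) → Set
Checked₂ L P rel = ForSmall₂ (λ a b → P a b → AnnihilatesOn (contexts L γ₀) γ₀ (rel a b))

Checked₃ : ℕ → (ℕ → ℕ → ℕ → Set) → (ℕ → ℕ → ℕ → Poly) → Set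
Checked₃ L P rel = ForSmall₃ (λ a b c → P a b c → AnnihilatesOn (contexts L γ₀) γ₀ (rel a b c))

check₂ : ∀ L {P} → (∀ a b → Dec (P a b)) → ∀ rel → Dec (Checked₂ L P rel)
check₂ L P? rel = all? (λ a → all? (λ b → P? a b →-dec annihilatesOn? (contexts L γ₀) γ₀ (rel a b)) small) small

check₃ : ∀ L {P} → (∀ a b c → Dec (P a b c)) → ∀ rel → Dec (Checked₃ L P rel)
check₃ L P? rel = all? (λ a → check₂ L (P? a) (rel a)) small

Adjacent NonAdjacent : ℕ → ℕ → Set
Adjacent    a b = b ≡ suc a
NonAdjacent a b = 2 + a ≤ b

Increasing : ℕ → ℕ → ℕ → Set
Increasing a b c = a < b × b < c

relA-adjacent : Checked₂ 3 Adjacent relA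
relA-adjacent = from-yes (check₂ 3 (λ a b → b ℕP.≟ suc a) relA)

relA-increasing : Checked₂ 3 _<_ relA
relA-increasing = from-yes (check₂ 3 ℕP._<?_ relA)

relS2-nonadjacent : Checked₂ 3 NonAdjacent relS2
relS2-nonadjacent = from-yes (check₂ 3 (λ a b → 2 + a ℕP.≤? b) relS2)

relS3-nonadjacent : Checked₂ 3 NonAdjacent relS3
relS3-nonadjacent = from-yes (check₂ 3 (λ a b → 2 + a ℕP.≤? b) relS3)

relB-increasing : Checked₃ 3 Increasing relB
relB-increasing = from-yes (check₃ 3 (λ a b c → (a ℕP.<? b) ×-dec (b ℕP.<? c)) relB)

relC-increasing : Checked₃ 4 Increasing relC
relC-increasing = from-yes (check₃ 4 (λ a b c → (a ℕP.<? b) ×-dec (b ℕP.<? c)) relC)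

module _ {a b : ℕ} where
  private
    pattern ∈₁ = here refl
    pattern ∈₂ = there (here refl)
    pattern ∈₃ = there (there (here refl))
  relA-∋ : All (λ cw → b ∈ proj₂ cw) (relA a b)
  relA-∋ = ∈₁ ∷ ∈₂ ∷ ∈₁ ∷ ∈₁ ∷ []

  relS2-∋ : All (λ cw → b ∈ proj₂ cw) (relS2 a b)
  relS2-∋ = ∈₁ ∷ ∈₁ ∷ []

  relS3-∋ : All (λ cw → b ∈ proj₂ cw) (relS3 a b)
  relS3-∋ = ∈₁ ∷ ∈₂ ∷ []

  relB-∋ : ∀ {c} → All (λ cw → c ∈ proj₂ cw) (relB a b c)
  relB-∋ = ∈₂ ∷ ∈₂ ∷ ∈₃ ∷ ∈₁ ∷ []

  relC-∋ : ∀ {c} → All (λ cw → c ∈ proj₂ cw) (relC a b c)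
  relC-∋ = ∈₁ ∷ ∈₂ ∷ ∈₁ ∷ ∈₂ ∷ []

adjacent⇒< : ∀ {a b} → Adjacent a b → a < b
adjacent⇒< refl = ℕP.n<1+n _

nonAdjacent⇒< : ∀ {a b} → NonAdjacent a b → a < b
nonAdjacent⇒< gap = ℕP.≤-trans (ℕP.n≤1+n _) gap

γ₀-perp-S : ∀ N → Perp N (GenS N) γ₀
γ₀-perp-S N = perp-from-generators N (GenS N) γ₀ annihilates
  where
    annihilates : ∀ r → GenS N r → Annihilates γ₀ r
    annihilates _ (sA {a} {b} _ adj _) = annihilates-γ₀ 3 _ b (refl ∷ refl ∷ refl ∷ refl ∷ []) relA-∋
      (λ b≤6 → forSmall₂ relA-adjacent (adjacent⇒< adj) b≤6 adj)
    annihilates _ (sB {a} {b} _ gap _) = annihilates-γ₀ 3 _ b (refl ∷ refl ∷ []) relS2-∋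
      (λ b≤6 → forSmall₂ relS2-nonadjacent (nonAdjacent⇒< gap) b≤6 gap)
    annihilates _ (sC {a} {b} _ gap _) = annihilates-γ₀ 3 _ b (refl ∷ refl ∷ []) relS3-∋
      (λ b≤6 → forSmall₂ relS3-nonadjacent (nonAdjacent⇒< gap) b≤6 gap)
    annihilates _ (sD {a} {b} {c} _ a<b b<c _) = annihilates-γ₀ 3 _ c (refl ∷ refl ∷ refl ∷ refl ∷ []) relB-∋
      (λ c≤6 → forSmall₃ relB-increasing a<b b<c c≤6 (a<b , b<c))

γ₀-perp-C : ∀ N → Perp N (GenC N) γ₀
γ₀-perp-C N = perp-from-generators N (GenC N) γ₀ annihilates
  where
    annihilates : ∀ r → GenC N r → Annihilates γ₀ r
    annihilates _ (cA {a} {b} _ a<b _) = annihilates-γ₀ 3 _ b (refl ∷ refl ∷ refl ∷ refl ∷ []) relA-∋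
      (λ b≤6 → forSmall₂ relA-increasing a<b b≤6 a<b)
    annihilates _ (cB {a} {b} {c} _ a<b b<c _) = annihilates-γ₀ 3 _ c (refl ∷ refl ∷ refl ∷ refl ∷ []) relB-∋
      (λ c≤6 → forSmall₃ relB-increasing a<b b<c c≤6 (a<b , b<c))
    annihilates _ (cC {a} {b} {c} _ a<b b<c _) = annihilates-γ₀ 4 _ c (refl ∷ refl ∷ refl ∷ refl ∷ []) relC-∋
      (λ c≤6 → forSmall₃ relC-increasing a<b b<c c≤6 (a<b , b<c))

AllLarge : ℕ → Poly → Set
AllLarge k = All (λ cw → Large k (proj₂ cw))

module _ {k : ℕ} where

  vanishesAbove-shift : ∀ {h} u → VanishesAbove k h → VanishesAbove k (λ v → h (u ++ v))
  vanishesAbove-shift u vanish v large = vanish (u ++ v) (AnyP.++⁺ʳ u large)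

  eval-*ᵤ-large : ∀ {h} B q → VanishesAbove k h → AllLarge k B → eval h (B *ᵤ q) ≡ + 0
  eval-*ᵤ-large {h} B q vanish large =
    trans (eval-*ᵤ h B q)
          (eval-zero-on B (All.map (λ {cw} w-large → eval-zero q (λ v → vanish (proj₂ cw ++ v) (AnyP.++⁺ˡ w-large))) large))

  eval-drop-largeˡ : ∀ {h} A B q → VanishesAbove k h → AllLarge k B → eval h ((A ++ B) *ᵤ q) ≡ eval h (A *ᵤ q)
  eval-drop-largeˡ {h} A B q vanish large = begin
      eval h ((A ++ B) *ᵤ q)
    ≡⟨ cong (eval h) (LP.concatMap-++ _ A B) ⟩
      eval h (A *ᵤ q ++ B *ᵤ q)
    ≡⟨ eval-++ h (A *ᵤ q) (B *ᵤ q) ⟩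
      eval h (A *ᵤ q) ℤ.+ eval h (B *ᵤ q)
    ≡⟨ cong (ℤ._+_ (eval h (A *ᵤ q))) (eval-*ᵤ-large B q vanish large) ⟩
      eval h (A *ᵤ q) ℤ.+ + 0
    ≡⟨ ℤP.+-identityʳ _ ⟩
      eval h (A *ᵤ q)
    ∎ where open ≡-Reasoning

  eval-drop-largeʳ : ∀ {h} p A B q → VanishesAbove k h → AllLarge k B →
                     eval h (p *ᵤ ((A ++ B) *ᵤ q)) ≡ eval h (p *ᵤ (A *ᵤ q))
  eval-drop-largeʳ {h} p A B q vanish large =
    trans (eval-*ᵤ h p _)
          (trans (eval-cong p (λ u → eval-drop-largeˡ A B q (vanishesAbove-shift u vanish) large))
                 (sym (eval-*ᵤ h p _)))

-- 𝔍₂₂₂ = e₃e₃ − e₄e₂, in the form produced by unfolding the determinant.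
jacobiTrudi₂₂₂ : Poly → Poly → Poly → Poly
jacobiTrudi₂₂₂ E₂ E₃ E₄ = scale (+ 1) (E₃ *ᵤ (E₃ *ᵤ one)) ++ (scale (ℤ.- + 1) (E₄ *ᵤ (E₂ *ᵤ one)) ++ [])

𝔍₂₂₂-unfold : ∀ N → 𝔍 N (2 ∷ 2 ∷ 2 ∷ []) ≡ jacobiTrudi₂₂₂ (e N (+ 2)) (e N (+ 3)) (e N (+ 4))
𝔍₂₂₂-unfold N = refl

eval-jacobiTrudi₂₂₂ : ∀ h E₂ E₃ E₄ →
  eval h (jacobiTrudi₂₂₂ E₂ E₃ E₄) ≡ eval h (E₃ *ᵤ (E₃ *ᵤ one)) ℤ.- eval h (E₄ *ᵤ (E₂ *ᵤ one))
eval-jacobiTrudi₂₂₂ h E₂ E₃ E₄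
  rewrite eval-++ h (scale (+ 1) (E₃ *ᵤ (E₃ *ᵤ one))) (scale (ℤ.- + 1) (E₄ *ᵤ (E₂ *ᵤ one)) ++ [])
        | eval-++ h (scale (ℤ.- + 1) (E₄ *ᵤ (E₂ *ᵤ one))) []
        | eval-scale h (+ 1) (E₃ *ᵤ (E₃ *ᵤ one))
        | eval-scale h (ℤ.- + 1) (E₄ *ᵤ (E₂ *ᵤ one))
  = cong₂ ℤ._+_ (ℤP.*-identityˡ (eval h (E₃ *ᵤ (E₃ *ᵤ one))))
                (trans (ℤP.+-identityʳ _) (ℤP.-1*i≡-i (eval h (E₄ *ᵤ (E₂ *ᵤ one)))))

eval-jacobiTrudi₂₂₂-drop-large : ∀ {k h} E₂ E₃ E₄ B₂ B₃ B₄ → VanishesAbove k h →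
  AllLarge k B₂ → AllLarge k B₃ → AllLarge k B₄ →
  eval h (jacobiTrudi₂₂₂ (E₂ ++ B₂) (E₃ ++ B₃) (E₄ ++ B₄)) ≡ eval h (jacobiTrudi₂₂₂ E₂ E₃ E₄)
eval-jacobiTrudi₂₂₂-drop-large {k} {h} E₂ E₃ E₄ B₂ B₃ B₄ vanish l₂ l₃ l₄ = begin
    eval h (jacobiTrudi₂₂₂ (E₂ ++ B₂) (E₃ ++ B₃) (E₄ ++ B₄))
  ≡⟨ eval-jacobiTrudi₂₂₂ h (E₂ ++ B₂) (E₃ ++ B₃) (E₄ ++ B₄) ⟩
    eval h ((E₃ ++ B₃) *ᵤ ((E₃ ++ B₃) *ᵤ one)) ℤ.- eval h ((E₄ ++ B₄) *ᵤ ((E₂ ++ B₂) *ᵤ one))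
  ≡⟨ cong₂ ℤ._-_ (drop₂ E₃ B₃ E₃ B₃ l₃ l₃) (drop₂ E₄ B₄ E₂ B₂ l₄ l₂) ⟩
    eval h (E₃ *ᵤ (E₃ *ᵤ one)) ℤ.- eval h (E₄ *ᵤ (E₂ *ᵤ one))
  ≡⟨ eval-jacobiTrudi₂₂₂ h E₂ E₃ E₄ ⟨
    eval h (jacobiTrudi₂₂₂ E₂ E₃ E₄)
  ∎ where
    open ≡-Reasoning
    drop₂ : ∀ A B A′ B′ → AllLarge k B → AllLarge k B′ →
            eval h ((A ++ B) *ᵤ ((A′ ++ B′) *ᵤ one)) ≡ eval h (A *ᵤ (A′ *ᵤ one))
    drop₂ A B A′ B′ l l′ = trans (eval-drop-largeˡ A B ((A′ ++ B′) *ᵤ one) vanish l) (eval-drop-largeʳ A A′ B′ one vanish l′)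

lettersAbove6 : ℕ → List ℕ
lettersAbove6 n = drop 6 (map suc (upTo (6 + n)))

decWordsAbove6 : ℕ → ℕ → List Word
decWordsAbove6 k n = concatMap (λ a → map (a ∷_) (decWords k (a ∸ 1))) (lettersAbove6 n)

decWords-split : ∀ n k → decWords (suc k) (6 + n) ≡ decWords (suc k) 6 ++ decWordsAbove6 k n
decWords-split n k = LP.concatMap-++ (λ a → map (a ∷_) (decWords k (a ∸ 1))) (map suc (upTo 6)) (lettersAbove6 n)

e-split : ∀ n k → e (6 + n) (+ suc k) ≡ e 6 (+ suc k) ++ map (λ w → (+ 1 , w)) (decWordsAbove6 k n)
e-split n k = trans (cong (map (λ w → (+ 1 , w))) (decWords-split n k)) (LP.map-++ _ (decWords (suc k) 6) _)

decWordsAbove6-large : ∀ k n → All (Large 6) (decWordsAbove6 k n)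
decWordsAbove6-large k n = AllP.concat⁺ (AllP.map⁺ (All.map (λ 6<a → AllP.map⁺ (All.universal (λ _ → here 6<a) _)) firstLetters))
  where
    firstLetters : All (6 <_) (lettersAbove6 n)
    firstLetters = AllP.map⁺ (AllP.applyUpTo⁺₂ _ n (λ i → s≤s (s≤s (s≤s (s≤s (s≤s (s≤s (s≤s z≤n))))))))

pair-𝔍₂₂₂-γ₀ : ∀ N → 6 ≤ N → pair (𝔍 N (2 ∷ 2 ∷ 2 ∷ [])) γ₀ ≡ -[1+ 0 ]
pair-𝔍₂₂₂-γ₀ N 6≤N with n , refl ← ℕP.m≤n⇒∃[o]m+o≡n 6≤N
  rewrite 𝔍₂₂₂-unfold (6 + n) | e-split n 1 | e-split n 2 | e-split n 3 =
    -- the value −1 at N = 6 is obtained by evaluation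
    eval-jacobiTrudi₂₂₂-drop-large (e 6 (+ 2)) (e 6 (+ 3)) (e 6 (+ 4)) (above 1) (above 2) (above 3)
      coeff-γ₀-vanishesAbove6 (above-large 1) (above-large 2) (above-large 3)
  where
    above : ℕ → Poly
    above k = map (λ w → (+ 1 , w)) (decWordsAbove6 k n)
    above-large : ∀ k → AllLarge 6 (above k)
    above-large k = AllP.map⁺ (decWordsAbove6-large k n)

-- Nonnegative elements of I^⊥ obstruct ℚ-monomial positivity

coeff-nonneg : ∀ γ w → NonNeg γ → + 0 ℤ.≤ coeff γ w
coeff-nonneg []            w []          = +≤+ z≤n
coeff-nonneg ((c , v) ∷ γ) w (0≤c ∷ 0≤γ) with wordEq v w
... | true  = ℤP.+-mono-≤ 0≤c (coeff-nonneg γ w 0≤γ)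
... | false = ℤP.+-mono-≤ (+≤+ z≤n) (coeff-nonneg γ w 0≤γ)

eval-nonneg : ∀ h p → (∀ w → + 0 ℤ.≤ h w) → NonNeg p → + 0 ℤ.≤ eval h p
eval-nonneg h []            0≤h []          = +≤+ z≤n
eval-nonneg h ((c , w) ∷ p) 0≤h (0≤c ∷ 0≤p) =
  ℤP.+-mono-≤ (*-nonneg 0≤c (0≤h w)) (eval-nonneg h p 0≤h 0≤p)
  where
    *-nonneg : ∀ {i j} → + 0 ℤ.≤ i → + 0 ℤ.≤ j → + 0 ℤ.≤ i ℤ.* j
    *-nonneg {+ a} {+ b} _ _ = subst (+ 0 ℤ.≤_) (ℤP.pos-* a b) (+≤+ z≤n)

pair-nonneg : ∀ g γ → NonNeg g → NonNeg γ → + 0 ℤ.≤ pair g γ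
pair-nonneg g γ 0≤g 0≤γ = eval-nonneg (coeff γ) g (λ w → coeff-nonneg γ w 0≤γ) 0≤g

¬QMonPos-from-perp : ∀ N Gen γ f → NonNeg γ → Perp N Gen γ → pair f γ ℤ.< + 0 → ¬ QMonPos N Gen f
¬QMonPos-from-perp N Gen γ f 0≤γ perp f<0 (suc m , _ , g , 0≤g , _ , mf-g∈I) =
  ℤP.<-irrefl (perp (scale (+ suc m) f ++ scale (ℤ.- + 1) g) mf-g∈I) (begin-strict
    pair (scale (+ suc m) f ++ scale (ℤ.- + 1) g) γ
  ≡⟨ eval-++ (coeff γ) (scale (+ suc m) f) (scale (ℤ.- + 1) g) ⟩
    pair (scale (+ suc m) f) γ ℤ.+ pair (scale (ℤ.- + 1) g) γ
  ≡⟨ cong₂ ℤ._+_ (eval-scale (coeff γ) (+ suc m) f)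
                 (trans (eval-scale (coeff γ) (ℤ.- + 1) g) (ℤP.-1*i≡-i (pair g γ))) ⟩
    + suc m ℤ.* pair f γ ℤ.- pair g γ
  <⟨ ℤP.+-mono-<-≤ (ℤP.*-monoˡ-<-pos (+ suc m) f<0) (ℤP.neg-mono-≤ (pair-nonneg g γ 0≤g 0≤γ)) ⟩
    + suc m ℤ.* + 0 ℤ.- + 0
  ≡⟨ trans (ℤP.+-identityʳ _) (ℤP.*-zeroʳ (+ suc m)) ⟩
    + 0
  ∎)
  where open ℤP.≤-Reasoning

allᵇ⁻ : ∀ (p : A → Bool) xs → T (allᵇ p xs) → All (T ∘ p) xs
allᵇ⁻ p []       _  = []
allᵇ⁻ p (x ∷ xs) px∧ = proj₁ (Equivalence.to T-∧ px∧) ∷ allᵇ⁻ p xs (proj₂ (Equivalence.to T-∧ px∧))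

allᵇ⁺ : ∀ (p : A → Bool) {xs} → All (T ∘ p) xs → T (allᵇ p xs)
allᵇ⁺ p []         = _
allᵇ⁺ p (px ∷ pxs) = Equivalence.from T-∧ (px , allᵇ⁺ p pxs)

allᵇ-cong : ∀ (p q : A → Bool) {xs} → All (λ x → p x ≡ q x) xs → allᵇ p xs ≡ allᵇ q xs
allᵇ-cong p q []           = refl
allᵇ-cong p q (px≡qx ∷ eqs) = cong₂ _∧_ px≡qx (allᵇ-cong p q eqs)

allᵇ-map : ∀ (p : B → Bool) (f : A → B) xs → allᵇ p (map f xs) ≡ allᵇ (p ∘ f) xs
allᵇ-map p f []       = refl
allᵇ-map p f (x ∷ xs) = cong (p (f x) ∧_) (allᵇ-map p f xs)

filterᵇ-map : ∀ (p : B → Bool) (f : A → B) xs → filterᵇ p (map f xs) ≡ map f (filterᵇ (p ∘ f) xs)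
filterᵇ-map p f []       = refl
filterᵇ-map p f (x ∷ xs) with p (f x)
... | true  = cong (f x ∷_) (filterᵇ-map p f xs)
... | false = filterᵇ-map p f xs

filterᵇ-cong : ∀ (p q : A → Bool) {xs} → All (λ x → p x ≡ q x) xs → filterᵇ p xs ≡ filterᵇ q xs
filterᵇ-cong p q {[]}     []            = refl
filterᵇ-cong p q {x ∷ xs} (px≡qx ∷ eqs) with p x | q x
filterᵇ-cong p q {x ∷ xs} (refl ∷ eqs) | true  | .true  = cong (x ∷_) (filterᵇ-cong p q eqs)
filterᵇ-cong p q {x ∷ xs} (refl ∷ eqs) | false | .false = filterᵇ-cong p q eqs

-- vecs and fillings are iterated ⊗-products.
_⊗_ : List A → List (List A) → List (List A)
vs ⊗ ws = concatMap (λ v → map (v ∷_) ws) vs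

filterᵇ-⊗ : ∀ (p : A → Bool) (q r : List A → Bool) → (∀ v w → r (v ∷ w) ≡ (p v ∧ q w)) →
            ∀ vs ws → filterᵇ r (vs ⊗ ws) ≡ filterᵇ p vs ⊗ filterᵇ q ws
filterᵇ-⊗ p q r r≡ []       ws = refl
filterᵇ-⊗ p q r r≡ (v ∷ vs) ws
  rewrite LP.filter-++ (T? ∘ r) (map (v ∷_) ws) (vs ⊗ ws)
        | filterᵇ-⊗ p q r r≡ vs ws
        | filterᵇ-map r (v ∷_) ws
        | filterᵇ-cong (r ∘ (v ∷_)) (λ w → p v ∧ q w) (All.universal (r≡ v) ws)
  with p v
... | true  = refl
... | false = cong (λ xs → map (v ∷_) xs ++ (filterᵇ p vs ⊗ filterᵇ q ws))
                   (LP.filter-none (T? ∘ λ _ → false) (All.universal (λ _ ()) ws))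

map-⊗ : ∀ (f : A → B) vs ws → map (map f) (vs ⊗ ws) ≡ map f vs ⊗ map (map f) ws
map-⊗ f []       ws = refl
map-⊗ f (v ∷ vs) ws = begin
    map (map f) (map (v ∷_) ws ++ vs ⊗ ws)
  ≡⟨ LP.map-++ (map f) (map (v ∷_) ws) (vs ⊗ ws) ⟩
    map (map f) (map (v ∷_) ws) ++ map (map f) (vs ⊗ ws)
  ≡⟨ cong₂ _++_ (sym (LP.map-∘ ws)) (map-⊗ f vs ws) ⟩
    map (λ w → f v ∷ map f w) ws ++ (map f vs ⊗ map (map f) ws)
  ≡⟨ cong (_++ (map f vs ⊗ map (map f) ws)) (LP.map-∘ ws) ⟩
    map (f v ∷_) (map (map f) ws) ++ (map f vs ⊗ map (map f) ws)
  ∎ where open ≡-Reasoning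

All-⊗ : ∀ {P : A → Set} {Q R : List A → Set} {vs ws} → (∀ {v w} → P v → Q w → R (v ∷ w)) →
        All P vs → All Q ws → All R (vs ⊗ ws)
All-⊗ cons pvs qws = AllP.concat⁺ (AllP.map⁺ (All.map (λ pv → AllP.map⁺ (All.map (cons pv) qws)) pvs))

filterᵇ-absorb : ∀ (p q : A → Bool) → (∀ x → T (p x) → T (q x)) → ∀ xs → filterᵇ p (filterᵇ q xs) ≡ filterᵇ p xs
filterᵇ-absorb p q p⇒q []       = refl
filterᵇ-absorb p q p⇒q (x ∷ xs) with q x in qx | p x in px
... | true  | true  rewrite px = cong (x ∷_) (filterᵇ-absorb p q p⇒q xs)
... | true  | false rewrite px = filterᵇ-absorb p q p⇒q xs
... | false | false = filterᵇ-absorb p q p⇒q xs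
... | false | true  = ⊥-elim (subst T qx (p⇒q x (subst T (sym px) _)))

vecs-restrict : ∀ (q : ℕ → Bool) k vs → filterᵇ (allᵇ q) (vecs k vs) ≡ vecs k (filterᵇ q vs)
vecs-restrict q zero    vs = refl
vecs-restrict q (suc k) vs rewrite sym (vecs-restrict q k vs) =
  filterᵇ-⊗ q (allᵇ q) (allᵇ q) (λ _ _ → refl) vs (vecs k vs)

fillings-restrict : ∀ (q : ℕ → Bool) sh vs → filterᵇ (allᵇ (allᵇ q)) (fillings sh vs) ≡ fillings sh (filterᵇ q vs)
fillings-restrict q []       vs = refl
fillings-restrict q (l ∷ ls) vs rewrite sym (fillings-restrict q ls vs) | sym (vecs-restrict q l vs) =
  filterᵇ-⊗ (allᵇ q) (allᵇ (allᵇ q)) (allᵇ (allᵇ q)) (λ _ _ → refl) (vecs l vs) (fillings ls vs)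

vecs-map : ∀ (f : ℕ → ℕ) k vs → vecs k (map f vs) ≡ map (map f) (vecs k vs)
vecs-map f zero    vs = refl
vecs-map f (suc k) vs rewrite vecs-map f k vs = sym (map-⊗ f vs (vecs k vs))

fillings-map : ∀ (f : ℕ → ℕ) sh vs → fillings sh (map f vs) ≡ map (map (map f)) (fillings sh vs)
fillings-map f []       vs = refl
fillings-map f (l ∷ ls) vs rewrite fillings-map f ls vs | vecs-map f l vs = sym (map-⊗ (map f) (vecs l vs) (fillings ls vs))

vecs-entries : ∀ k vs → All (All (_∈ vs)) (vecs k vs)
vecs-entries zero    vs = [] ∷ []
vecs-entries (suc k) vs = All-⊗ _∷_ (All.tabulate (λ v∈vs → v∈vs)) (vecs-entries k vs)

fillings-entries : ∀ sh vs → All (All (All (_∈ vs))) (fillings sh vs)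
fillings-entries []       vs = [] ∷ []
fillings-entries (l ∷ ls) vs = All-⊗ _∷_ (vecs-entries l vs) (fillings-entries ls vs)

vecs-length : ∀ k vs → All (λ w → length w ≡ k) (vecs k vs)
vecs-length zero    vs = refl ∷ []
vecs-length (suc k) vs = All-⊗ (λ _ → cong suc) (All.universal (λ _ → tt) vs) (vecs-length k vs)

fillings-size : ∀ sh vs → All (λ T → length (concat T) ≡ sum sh) (fillings sh vs)
fillings-size []       vs = refl ∷ []
fillings-size (l ∷ ls) vs = All-⊗ (λ {r} r≡l T≡ls → trans (LP.length-++ r) (cong₂ ℕ._+_ r≡l T≡ls))
                                  (vecs-length l vs) (fillings-size ls vs)

countᵇ-++ : ∀ v xs ys → countᵇ v (xs ++ ys) ≡ countᵇ v xs + countᵇ v ys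
countᵇ-++ v xs ys = trans (cong length (LP.filter-++ (T? ∘ (v ≡ᵇ_)) xs ys)) (LP.length-++ (filterᵇ (v ≡ᵇ_) xs))

countᵇ-pos : ∀ {v} xs → v ∈ xs → 0 < countᵇ v xs
countᵇ-pos {v} xs v∈xs = LP.filter-some (T? ∘ (v ≡ᵇ_)) (Any.map (ℕP.≡⇒≡ᵇ v _) v∈xs)

countᵇ-pos⁻ : ∀ {v} xs → 0 < countᵇ v xs → v ∈ xs
countᵇ-pos⁻ {v} xs 0<count with filterᵇ (v ≡ᵇ_) xs in eq
... | x ∷ _ = let x∈xs , v≡ᵇx = ∈-filter⁻ (T? ∘ (v ≡ᵇ_)) (subst (x ∈_) (sym eq) (here refl))
              in subst (_∈ xs) (sym (ℕP.≡ᵇ⇒≡ v x v≡ᵇx)) x∈xs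

countᵇ-absent : ∀ {v} xs → v ∉ xs → countᵇ v xs ≡ 0
countᵇ-absent {v} xs v∉xs with countᵇ v xs in eq
... | zero  = refl
... | suc _ = ⊥-elim (v∉xs (countᵇ-pos⁻ xs (subst (0 <_) (sym eq) z<s)))

length-from-countᵇ : ∀ xs ys → (∀ v → countᵇ v xs ≡ countᵇ v ys) → length xs ≡ length ys
length-from-countᵇ []       []       _     = refl
length-from-countᵇ []       (y ∷ ys) same = ⊥-elim (ℕP.<-irrefl (same y) (countᵇ-pos (y ∷ ys) (here refl)))
length-from-countᵇ (x ∷ xs) ys       same with ys₁ , ys₂ , refl ← ∈-∃++ (countᵇ-pos⁻ {x} ys (subst (0 <_) (same x) (countᵇ-pos (x ∷ xs) (here refl)))) =
  begin
    suc (length xs)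
  ≡⟨ cong suc (length-from-countᵇ xs (ys₁ ++ ys₂) same′) ⟩
    suc (length (ys₁ ++ ys₂))
  ≡⟨ cong suc (LP.length-++ ys₁) ⟩
    suc (length ys₁ + length ys₂)
  ≡⟨ ℕP.+-suc (length ys₁) (length ys₂) ⟨
    length ys₁ + length (x ∷ ys₂)
  ≡⟨ LP.length-++ ys₁ ⟨
    length (ys₁ ++ x ∷ ys₂)
  ∎ where
    open ≡-Reasoning
    same′ : ∀ v → countᵇ v xs ≡ countᵇ v (ys₁ ++ ys₂)
    same′ v = ℕP.+-cancelˡ-≡ (countᵇ v (x ∷ [])) _ _ (begin
        countᵇ v (x ∷ []) + countᵇ v xs
      ≡⟨ trans (sym (countᵇ-++ v (x ∷ []) xs)) (same v) ⟩
        countᵇ v (ys₁ ++ (x ∷ []) ++ ys₂)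
      ≡⟨ trans (countᵇ-++ v ys₁ _) (cong (ℕ._+_ (countᵇ v ys₁)) (countᵇ-++ v (x ∷ []) ys₂)) ⟩
        countᵇ v ys₁ + (countᵇ v (x ∷ []) + countᵇ v ys₂)
      ≡⟨ ℕP.+-comm (countᵇ v ys₁) _ ⟩
        (countᵇ v (x ∷ []) + countᵇ v ys₂) + countᵇ v ys₁
      ≡⟨ ℕP.+-assoc (countᵇ v (x ∷ [])) _ _ ⟩
        countᵇ v (x ∷ []) + (countᵇ v ys₂ + countᵇ v ys₁)
      ≡⟨ cong (ℕ._+_ (countᵇ v (x ∷ []))) (trans (ℕP.+-comm (countᵇ v ys₂) _) (sym (countᵇ-++ v ys₁ ys₂))) ⟩
        countᵇ v (x ∷ []) + countᵇ v (ys₁ ++ ys₂)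
      ∎)

sameContent-countᵇ : ∀ xs ys → T (sameContent xs ys) → ∀ v → countᵇ v xs ≡ countᵇ v ys
sameContent-countᵇ xs ys same v with v ∈? (xs ++ ys)
... | yes v∈ = ℕP.≡ᵇ⇒≡ _ _ (All.lookup (allᵇ⁻ (λ v → countᵇ v xs ≡ᵇ countᵇ v ys) (xs ++ ys) same) v∈)
... | no  v∉ = trans (countᵇ-absent xs (v∉ ∘ ∈-++⁺ˡ)) (sym (countᵇ-absent ys (v∉ ∘ ∈-++⁺ʳ xs)))

sameContent-length : ∀ xs ys → T (sameContent xs ys) → length xs ≡ length ys
sameContent-length xs ys same = length-from-countᵇ xs ys (sameContent-countᵇ xs ys same)

sameContent-⊆ : ∀ xs ys → T (sameContent xs ys) → ∀ {v} → v ∈ xs → v ∈ ys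
sameContent-⊆ xs ys same {v} v∈xs = countᵇ-pos⁻ ys (subst (0 <_) (sameContent-countᵇ xs ys same v) (countᵇ-pos xs v∈xs))

-- Schur functions under order-preserving relabelling

occursIn : List ℕ → ℕ → Bool
occursIn i v = isYes (v ∈? i)

alphabet : List ℕ → List ℕ
alphabet i = filterᵇ (occursIn i) (upTo (suc (maxℕ i)))

IsSSYTWithContent : List ℕ → List (List ℕ) → Bool
IsSSYTWithContent i t = isSSYT t ∧ sameContent (concat t) i

≤-maxℕ : ∀ {x} i → x ∈ i → x ≤ maxℕ i
≤-maxℕ (y ∷ i) (here refl) = ℕP.m≤m⊔n y (maxℕ i)
≤-maxℕ (y ∷ i) (there x∈i) = ℕP.≤-trans (≤-maxℕ i x∈i) (ℕP.m≤n⊔m y (maxℕ i))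

∈-alphabet⁺ : ∀ {x} i → x ∈ i → x ∈ alphabet i
∈-alphabet⁺ i x∈i = ∈-filter⁺ (T? ∘ occursIn i) (∈-upTo⁺ (s≤s (≤-maxℕ i x∈i))) (fromWitness x∈i)

∈-alphabet⁻ : ∀ {x} i → x ∈ alphabet i → x ∈ i
∈-alphabet⁻ i x∈ = toWitness (proj₂ (∈-filter⁻ (T? ∘ occursIn i) x∈))

alphabet-increasing : ∀ i → Linked _<_ (alphabet i)
alphabet-increasing i = LinkedP.filter⁺ (T? ∘ occursIn i) ℕP.<-trans
  (LinkedP.applyUpTo⁺₂ (λ x → x) (suc (maxℕ i)) (λ j → ℕP.n<1+n j))

SSYTWithContent⇒letters : ∀ i t → T (IsSSYTWithContent i t) → T (allᵇ (allᵇ (occursIn i)) t)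
SSYTWithContent⇒letters i t ok = allᵇ⁺ (allᵇ (occursIn i)) {t} (All.tabulate (λ {r} r∈t → allᵇ⁺ (occursIn i) (All.tabulate (λ v∈r →
  fromWitness (sameContent-⊆ (concat t) i (proj₂ (Equivalence.to T-∧ ok)) (∈-concat⁺′ v∈r r∈t))))))

schur-alphabet : ∀ sh i → schur sh i ≡ + length (filterᵇ (IsSSYTWithContent i) (fillings sh (alphabet i)))
schur-alphabet sh i = cong (+_ ∘ length) (begin
    filterᵇ (IsSSYTWithContent i) (fillings sh (upTo (suc (maxℕ i))))
  ≡⟨ filterᵇ-absorb (IsSSYTWithContent i) _ (SSYTWithContent⇒letters i) (fillings sh (upTo (suc (maxℕ i)))) ⟨
    filterᵇ (IsSSYTWithContent i) (filterᵇ (allᵇ (allᵇ (occursIn i))) (fillings sh (upTo (suc (maxℕ i)))))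
  ≡⟨ cong (filterᵇ (IsSSYTWithContent i)) (fillings-restrict (occursIn i) sh (upTo (suc (maxℕ i)))) ⟩
    filterᵇ (IsSSYTWithContent i) (fillings sh (alphabet i))
  ∎) where open ≡-Reasoning

StrictlyMonotoneOn : List ℕ → (ℕ → ℕ) → Set
StrictlyMonotoneOn S f = ∀ {a b} → a ∈ S → b ∈ S → a < b → f a < f b

bool-ext : ∀ {b c : Bool} → (T b → T c) → (T c → T b) → b ≡ c
bool-ext {false} {false} _ _ = refl
bool-ext {false} {true}  _ c⇒b = ⊥-elim (c⇒b _)
bool-ext {true}  {false} b⇒c _ = ⊥-elim (b⇒c _)
bool-ext {true}  {true}  _ _ = refl

module Relabel {S : List ℕ} {f : ℕ → ℕ} (mono : StrictlyMonotoneOn S f) where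

  <-reflect : ∀ {a b} → a ∈ S → b ∈ S → f a < f b → a < b
  <-reflect {a} {b} a∈S b∈S fa<fb with ℕP.<-cmp a b
  ... | tri< a<b _ _ = a<b
  ... | tri≈ _ refl _ = ⊥-elim (ℕP.<-irrefl refl fa<fb)
  ... | tri> _ _ b<a = ⊥-elim (ℕP.<-asym fa<fb (mono b∈S a∈S b<a))

  ≤-mono : ∀ {a b} → a ∈ S → b ∈ S → a ≤ b → f a ≤ f b
  ≤-mono a∈S b∈S a≤b = ℕP.≮⇒≥ (λ fb<fa → ℕP.<⇒≱ (<-reflect b∈S a∈S fb<fa) a≤b)

  ≤-reflect : ∀ {a b} → a ∈ S → b ∈ S → f a ≤ f b → a ≤ b
  ≤-reflect a∈S b∈S fa≤fb = ℕP.≮⇒≥ (λ b<a → ℕP.<⇒≱ (mono b∈S a∈S b<a) fa≤fb)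

  <ᵇ-relabel : ∀ {a b} → a ∈ S → b ∈ S → (f a <ᵇ f b) ≡ (a <ᵇ b)
  <ᵇ-relabel a∈S b∈S = bool-ext (ℕP.<⇒<ᵇ ∘ <-reflect a∈S b∈S ∘ ℕP.<ᵇ⇒< _ _)
                                (ℕP.<⇒<ᵇ ∘ mono a∈S b∈S ∘ ℕP.<ᵇ⇒< _ _)

  ≤ᵇ-relabel : ∀ {a b} → a ∈ S → b ∈ S → (f a ≤ᵇ f b) ≡ (a ≤ᵇ b)
  ≤ᵇ-relabel a∈S b∈S = bool-ext (ℕP.≤⇒≤ᵇ ∘ ≤-reflect a∈S b∈S ∘ ℕP.≤ᵇ⇒≤ _ _)
                                (ℕP.≤⇒≤ᵇ ∘ ≤-mono a∈S b∈S ∘ ℕP.≤ᵇ⇒≤ _ _)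

  ≡ᵇ-relabel : ∀ {a b} → a ∈ S → b ∈ S → (f a ≡ᵇ f b) ≡ (a ≡ᵇ b)
  ≡ᵇ-relabel a∈S b∈S = bool-ext
    (ℕP.≡⇒≡ᵇ _ _ ∘ (λ fa≡fb → ℕP.≤-antisym (≤-reflect a∈S b∈S (ℕP.≤-reflexive fa≡fb))
                                            (≤-reflect b∈S a∈S (ℕP.≤-reflexive (sym fa≡fb)))) ∘ ℕP.≡ᵇ⇒≡ _ _)
    (ℕP.≡⇒≡ᵇ _ _ ∘ cong f ∘ ℕP.≡ᵇ⇒≡ _ _)

  Over : List ℕ → Set
  Over = All (_∈ S)

  rowWeak-relabel : ∀ {r} → Over r → rowWeak (map f r) ≡ rowWeak r
  rowWeak-relabel []                 = refl
  rowWeak-relabel (_ ∷ [])           = refl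
  rowWeak-relabel (a∈ ∷ b∈ ∷ r∈) = cong₂ _∧_ (≤ᵇ-relabel a∈ b∈) (rowWeak-relabel (b∈ ∷ r∈))

  colStrict-relabel : ∀ {r s} → Over r → Over s → colStrict (map f r) (map f s) ≡ colStrict r s
  colStrict-relabel []         _          = refl
  colStrict-relabel (_ ∷ _)    []         = refl
  colStrict-relabel (a∈ ∷ r∈) (b∈ ∷ s∈) = cong₂ _∧_ (<ᵇ-relabel a∈ b∈) (colStrict-relabel r∈ s∈)

  colsStrict-relabel : ∀ {t} → All Over t → colsStrict (map (map f) t) ≡ colsStrict t
  colsStrict-relabel []                = refl
  colsStrict-relabel (_ ∷ [])          = refl
  colsStrict-relabel (r∈ ∷ s∈ ∷ t∈) = cong₂ _∧_ (colStrict-relabel r∈ s∈) (colsStrict-relabel (s∈ ∷ t∈))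

  isSSYT-relabel : ∀ {t} → All Over t → isSSYT (map (map f) t) ≡ isSSYT t
  isSSYT-relabel {t} t∈ =
    cong₂ _∧_ (trans (allᵇ-map rowWeak (map f) t) (allᵇ-cong _ _ (All.map rowWeak-relabel t∈)))
              (colsStrict-relabel t∈)

  countᵇ-relabel : ∀ {v xs} → v ∈ S → Over xs → countᵇ (f v) (map f xs) ≡ countᵇ v xs
  countᵇ-relabel {v} {xs} v∈ xs∈ = begin
      length (filterᵇ (f v ≡ᵇ_) (map f xs))
    ≡⟨ cong length (filterᵇ-map (f v ≡ᵇ_) f xs) ⟩
      length (map f (filterᵇ (λ x → f v ≡ᵇ f x) xs))
    ≡⟨ LP.length-map f (filterᵇ (λ x → f v ≡ᵇ f x) xs) ⟩
      length (filterᵇ (λ x → f v ≡ᵇ f x) xs)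
    ≡⟨ cong length (filterᵇ-cong _ _ (All.map (≡ᵇ-relabel v∈) xs∈)) ⟩
      length (filterᵇ (v ≡ᵇ_) xs)
    ∎ where open ≡-Reasoning

  sameContent-relabel : ∀ {xs ys} → Over xs → Over ys → sameContent (map f xs) (map f ys) ≡ sameContent xs ys
  sameContent-relabel {xs} {ys} xs∈ ys∈ = begin
      allᵇ (λ v → countᵇ v (map f xs) ≡ᵇ countᵇ v (map f ys)) (map f xs ++ map f ys)
    ≡⟨ cong (allᵇ _) (LP.map-++ f xs ys) ⟨
      allᵇ (λ v → countᵇ v (map f xs) ≡ᵇ countᵇ v (map f ys)) (map f (xs ++ ys))
    ≡⟨ allᵇ-map _ f (xs ++ ys) ⟩
      allᵇ (λ v → countᵇ (f v) (map f xs) ≡ᵇ countᵇ (f v) (map f ys)) (xs ++ ys)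
    ≡⟨ allᵇ-cong _ _ (All.map (λ v∈ → cong₂ _≡ᵇ_ (countᵇ-relabel v∈ xs∈) (countᵇ-relabel v∈ ys∈)) (AllP.++⁺ xs∈ ys∈)) ⟩
      allᵇ (λ v → countᵇ v xs ≡ᵇ countᵇ v ys) (xs ++ ys)
    ∎ where open ≡-Reasoning

  IsSSYTWithContent-relabel : ∀ {c t} → Over c → All Over t →
    IsSSYTWithContent (map f c) (map (map f) t) ≡ IsSSYTWithContent c t
  IsSSYTWithContent-relabel {c} {t} c∈ t∈ = cong₂ _∧_ (isSSYT-relabel t∈)
    (trans (cong (λ xs → sameContent xs (map f c)) (LP.concat-map t))
           (sameContent-relabel (AllP.concat⁺ t∈) c∈))

increasing-head : ∀ {x xs} → Linked _<_ (x ∷ xs) → All (x <_) xs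
increasing-head [-]         = []
increasing-head (x<y ∷ ↗xs) = LinkedP.Linked⇒All ℕP.<-trans x<y ↗xs

increasing-≡ : ∀ {xs ys} → Linked _<_ xs → Linked _<_ ys →
               (∀ {z} → z ∈ xs → z ∈ ys) → (∀ {z} → z ∈ ys → z ∈ xs) → xs ≡ ys
increasing-≡ {[]}     {[]}     _  _  _     _     = refl
increasing-≡ {[]}     {y ∷ ys} _  _  _     ys⊆xs with () ← ys⊆xs (here refl)
increasing-≡ {x ∷ xs} {[]}     _  _  xs⊆ys _     with () ← xs⊆ys (here refl)
increasing-≡ {x ∷ xs} {y ∷ ys} ↗xs ↗ys xs⊆ys ys⊆xs = cong₂ _∷_ x≡y (increasing-≡ (Linked.tail ↗xs) (Linked.tail ↗ys) tail⊆ tail⊇)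
  where
    x< : All (x <_) xs
    x< = increasing-head ↗xs
    y< : All (y <_) ys
    y< = increasing-head ↗ys
    x≡y : x ≡ y
    x≡y with xs⊆ys (here refl) | ys⊆xs (here refl)
    ... | here x≡y  | _          = x≡y
    ... | there _   | here y≡x   = sym y≡x
    ... | there x∈ys | there y∈xs = ⊥-elim (ℕP.<-asym (All.lookup y< x∈ys) (All.lookup x< y∈xs))
    tail⊆ : ∀ {z} → z ∈ xs → z ∈ ys
    tail⊆ z∈xs with xs⊆ys (there z∈xs)
    ... | here refl = ⊥-elim (ℕP.<-irrefl x≡y (All.lookup x< z∈xs))
    ... | there z∈ys = z∈ys
    tail⊇ : ∀ {z} → z ∈ ys → z ∈ xs
    tail⊇ z∈ys with ys⊆xs (there z∈ys)
    ... | here refl = ⊥-elim (ℕP.<-irrefl (sym x≡y) (All.lookup y< z∈ys))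
    ... | there z∈xs = z∈xs

module _ {c : List ℕ} {f : ℕ → ℕ} (mono : StrictlyMonotoneOn c f) where
  open Relabel mono

  map-increasing : ∀ {xs} → Over xs → Linked _<_ xs → Linked _<_ (map f xs)
  map-increasing _               []            = []
  map-increasing _               [-]           = [-]
  map-increasing (x∈ ∷ y∈ ∷ xs∈) (x<y ∷ ↗xs) = mono x∈ y∈ x<y ∷ map-increasing (y∈ ∷ xs∈) ↗xs

  alphabet-relabel : alphabet (map f c) ≡ map f (alphabet c)
  alphabet-relabel = increasing-≡ (alphabet-increasing (map f c))
    (map-increasing (All.tabulate (∈-alphabet⁻ c)) (alphabet-increasing c))
    (λ z∈ → image (∈-map⁻ f (∈-alphabet⁻ (map f c) z∈)) (∈-map⁺ f ∘ ∈-alphabet⁺ c))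
    (λ z∈ → image (∈-map⁻ f z∈) (∈-alphabet⁺ (map f c) ∘ ∈-map⁺ f ∘ ∈-alphabet⁻ c))
    where
      image : ∀ {z xs} {P : ℕ → Set} → ∃[ y ] y ∈ xs × z ≡ f y → (∀ {y} → y ∈ xs → P (f y)) → P z
      image (_ , y∈ , refl) k = k y∈

  schur-relabel : ∀ sh → schur sh (map f c) ≡ schur sh c
  schur-relabel sh = begin
      schur sh (map f c)
    ≡⟨ schur-alphabet sh (map f c) ⟩
      + length (filterᵇ (IsSSYTWithContent (map f c)) (fillings sh (alphabet (map f c))))
    ≡⟨ cong (λ A → + length (filterᵇ (IsSSYTWithContent (map f c)) A))
            (trans (cong (fillings sh) alphabet-relabel) (fillings-map f sh (alphabet c))) ⟩
      + length (filterᵇ (IsSSYTWithContent (map f c)) (map (map (map f)) (fillings sh (alphabet c))))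
    ≡⟨ cong (+_ ∘ length) (filterᵇ-map _ (map (map f)) (fillings sh (alphabet c))) ⟩
      + length (map (map (map f)) (filterᵇ (IsSSYTWithContent (map f c) ∘ map (map f)) (fillings sh (alphabet c))))
    ≡⟨ cong +_ (LP.length-map (map (map f)) (filterᵇ (IsSSYTWithContent (map f c) ∘ map (map f)) (fillings sh (alphabet c)))) ⟩
      + length (filterᵇ (IsSSYTWithContent (map f c) ∘ map (map f)) (fillings sh (alphabet c)))
    ≡⟨ cong (+_ ∘ length) (filterᵇ-cong _ _ (All.map relabel (fillings-entries sh (alphabet c)))) ⟩
      + length (filterᵇ (IsSSYTWithContent c) (fillings sh (alphabet c)))
    ≡⟨ schur-alphabet sh c ⟨
      schur sh c
    ∎ where
      open ≡-Reasoning
      relabel : ∀ {t} → All (All (_∈ alphabet c)) t → IsSSYTWithContent (map f c) (map (map f) t) ≡ IsSSYTWithContent c t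
      relabel t∈ = IsSSYTWithContent-relabel (All.tabulate (λ x∈ → x∈)) (All.map (All.map (∈-alphabet⁻ c)) t∈)

schur-wrong-size : ∀ sh i → length i ≢ sum sh → schur sh i ≡ + 0
schur-wrong-size sh i ≢size = cong (+_ ∘ length) (LP.filter-none (T? ∘ IsSSYTWithContent i)
  (All.map (λ {t} size ok → ≢size (trans (sym (sameContent-length (concat t) i (proj₂ (Equivalence.to T-∧ ok)))) size))
           (fillings-size sh (upTo (suc (maxℕ i))))))

at-map : ∀ (f : ℕ → ℕ) xs {j} → 1 ≤ j → j ≤ length xs → at (map f xs) j ≡ f (at xs j)
at-map f (x ∷ xs) {suc zero}    _ _         = refl
at-map f (x ∷ xs) {suc (suc j)} _ (s≤s j≤) = at-map f xs (s≤s z≤n) j≤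

at-∈ : ∀ xs {j} → 1 ≤ j → j ≤ length xs → at xs j ∈ xs
at-∈ (x ∷ xs) {suc zero}    _ _         = here refl
at-∈ (x ∷ xs) {suc (suc j)} _ (s≤s j≤) = there (at-∈ xs (s≤s z≤n) j≤)

InnerPosition : ℕ → ℕ → Set
InnerPosition n j = 1 ≤ j × suc j ≤ n

DesBound : ℕ → ℕ → ℕ → Set
DesBound k n j = k ≤ j × suc j < k + n

desBound-shift : ∀ {k n j} → DesBound (suc k) (suc n) j → DesBound k (suc (suc n)) j
desBound-shift {k} {n} {j} (k<j , j<) = ℕP.<⇒≤ k<j , subst (suc j <_) (sym (ℕP.+-suc k (suc n))) j<

desBound-first : ∀ k n → DesBound k (suc (suc n)) k
desBound-first k n = ℕP.≤-refl , ℕP.≤-trans (ℕP.≤-reflexive (ℕP.+-comm 2 k)) (ℕP.+-monoʳ-≤ k (s≤s (s≤s z≤n)))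

desAux-bounds : ∀ k w → All (DesBound k (length w)) (desAux k w)
desAux-bounds k []          = []
desAux-bounds k (a ∷ [])    = []
desAux-bounds k (a ∷ b ∷ w) = step (b <ᵇ a) (All.map desBound-shift (desAux-bounds (suc k) (b ∷ w)))
  where
    step : ∀ d {js} → All (DesBound k (length (a ∷ b ∷ w))) js →
           All (DesBound k (length (a ∷ b ∷ w))) (if d then k ∷ js else js)
    step true  bounds = desBound-first k (length w) ∷ bounds
    step false bounds = bounds

Des-inner : ∀ w → All (InnerPosition (length w)) (Des w)
Des-inner w = All.map (λ { (1≤j , s≤s j<) → 1≤j , j< }) (desAux-bounds 1 w)

module _ {c : List ℕ} {f : ℕ → ℕ} (mono : StrictlyMonotoneOn c f) where
  open Relabel mono

  Q-relabel : ∀ n D → All (InnerPosition n) D → Q n D (map f c) ≡ Q n D c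
  Q-relabel n D inner rewrite LP.length-map f c with length c ≡ᵇ n in length≡ᵇ
  ... | false = refl
  ... | true  = cong (if_then + 1 else + 0) (allᵇ-cong _ _ (All.map ascent inner))
    where
      length≡ = ℕP.≡ᵇ⇒≡ (length c) n (subst T (sym length≡ᵇ) _)
      ascent : ∀ {j} → InnerPosition n j → (at (map f c) j <ᵇ at (map f c) (suc j)) ≡ (at c j <ᵇ at c (suc j))
      ascent (1≤j , j<n) rewrite sym length≡ =
        trans (cong₂ _<ᵇ_ (at-map f c 1≤j (ℕP.<⇒≤ j<n)) (at-map f c (s≤s z≤n) j<n))
              (<ᵇ-relabel (at-∈ c 1≤j (ℕP.<⇒≤ j<n)) (at-∈ c (s≤s z≤n) j<n))

  F-relabel : ∀ γ → F γ (map f c) ≡ F γ c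
  F-relabel []            = refl
  F-relabel ((d , w) ∷ γ) = cong₂ ℤ._+_ (cong (d ℤ.*_) (Q-relabel (length w) (Des w) (Des-inner w))) (F-relabel γ)

F-wrong-length : ∀ n γ i → All (λ cw → length (proj₂ cw) ≡ n) γ → length i ≢ n → F γ i ≡ + 0
F-wrong-length n []            i []             _    = refl
F-wrong-length n ((d , w) ∷ γ) i (refl ∷ lengths) i≢n with length i ≡ᵇ length w in eq
... | true  = ⊥-elim (i≢n (ℕP.≡ᵇ⇒≡ _ _ (subst T (sym eq) _)))
... | false = cong₂ ℤ._+_ (ℤP.*-zeroʳ d) (F-wrong-length n γ i lengths i≢n)

-- Standardization and the expansion of F γ₀

extend : List ℕ → List (List ℕ)
extend c = (0 ∷ c) ∷ (0 ∷ map suc c) ∷ []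

-- The standardizations of weakly increasing words of length n: they start at 0 and go up by 0 or 1.
patterns : ℕ → List (List ℕ)
patterns zero          = [] ∷ []
patterns (suc zero)    = (0 ∷ []) ∷ []
patterns (suc (suc n)) = concatMap extend (patterns (suc n))

pattern-head : ∀ {n c} → c ∈ patterns (suc n) → ∃[ c′ ] c ≡ 0 ∷ c′
pattern-head {zero}  (here refl) = [] , refl
pattern-head {suc n} {c} c∈ with Any.satisfied (∈-concatMap⁻ extend {patterns (suc n)} {c} c∈)
... | c′ , here refl         = c′ , refl
... | c′ , there (here refl) = map suc c′ , refl

record Standardization (i : List ℕ) : Set where
  field
    standard   : List ℕ
    label      : ℕ → ℕ
    standard∈  : standard ∈ patterns (length i)
    monotone   : StrictlyMonotoneOn standard label
    labelling  : map label standard ≡ i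

monotone-∷ : ∀ {a S f} → a ∈ S → StrictlyMonotoneOn S f → StrictlyMonotoneOn (a ∷ S) f
monotone-∷ a∈S mono a∈ b∈ = mono (absorb a∈) (absorb b∈)
  where
    absorb : ∀ {x} → x ∈ _ ∷ _ → x ∈ _
    absorb (here refl) = a∈S
    absorb (there x∈S) = x∈S

prepend : ℕ → (ℕ → ℕ) → ℕ → ℕ
prepend x f zero    = x
prepend x f (suc k) = f k

monotone-prepend : ∀ {x S f} → 0 ∈ S → StrictlyMonotoneOn S f → x < f 0 →
                   StrictlyMonotoneOn (0 ∷ map suc S) (prepend x f)
monotone-prepend {x} {S} {f} 0∈S mono x<f0 = go
  where
    f0≤ : ∀ {k} → k ∈ S → f 0 ≤ f k
    f0≤ {zero}  _   = ℕP.≤-refl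
    f0≤ {suc k} k∈S = ℕP.<⇒≤ (mono 0∈S k∈S (s≤s z≤n))
    go : StrictlyMonotoneOn (0 ∷ map suc S) (prepend x f)
    go (here refl) (here refl) ()
    go (here refl) (there b∈) _ with ∈-map⁻ suc b∈
    ... | k , k∈S , refl = ℕP.<-≤-trans x<f0 (f0≤ k∈S)
    go (there a∈) (here refl) ()
    go (there a∈) (there b∈) a<b with ∈-map⁻ suc a∈ | ∈-map⁻ suc b∈
    ... | k , k∈S , refl | l , l∈S , refl = mono k∈S l∈S (ℕP.≤-pred a<b)

standardize : ∀ i → Linked _≤_ i → Standardization i
standardize []           _ = record { standard = [] ; label = λ k → k ; standard∈ = here refl
                                    ; monotone = λ _ _ a<b → a<b ; labelling = refl }
standardize (x ∷ [])     _ = record { standard = 0 ∷ [] ; label = λ _ → x ; standard∈ = here refl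
                                    ; monotone = λ { (here refl) (here refl) () } ; labelling = refl }
standardize (x ∷ y ∷ ys) (x≤y ∷ ↗) with standardize (y ∷ ys) ↗
... | record { standard = c ; label = f ; standard∈ = c∈ ; monotone = mono ; labelling = f[c] }
  with pattern-head {length ys} c∈
... | c′ , refl with ℕP.m≤n⇒m<n∨m≡n x≤y
...   | inj₂ refl = record
  { standard  = 0 ∷ 0 ∷ c′
  ; label     = f
  ; standard∈ = ∈-concatMap⁺ extend (lose c∈ (here refl))
  ; monotone  = monotone-∷ (here refl) mono
  ; labelling = cong₂ _∷_ (LP.∷-injectiveˡ f[c]) f[c]
  }
...   | inj₁ x<y = record
  { standard  = 0 ∷ map suc (0 ∷ c′)
  ; label     = prepend x f
  ; standard∈ = ∈-concatMap⁺ extend (lose c∈ (there (here refl)))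
  ; monotone  = monotone-prepend (here refl) mono (subst (x <_) (sym (LP.∷-injectiveˡ f[c])) x<y)
  ; labelling = cong (x ∷_) (trans (sym (LP.map-∘ (0 ∷ c′))) f[c])
  }

expansion : Series
expansion = (schur (3 ∷ 2 ∷ 1 ∷ []) +ₛ schur (2 ∷ 2 ∷ 1 ∷ 1 ∷ [])) -ₛ schur (2 ∷ 2 ∷ 2 ∷ [])

F-γ₀-patterns : All (λ c → F γ₀ c ≡ expansion c) (patterns 6)
F-γ₀-patterns = from-yes (all? (λ c → F γ₀ c ℤP.≟ expansion c) (patterns 6))

expansion-relabel : ∀ {c f} → StrictlyMonotoneOn c f → expansion (map f c) ≡ expansion c
expansion-relabel mono = cong₂ ℤ._-_ (cong₂ ℤ._+_ (schur-relabel mono (3 ∷ 2 ∷ 1 ∷ [])) (schur-relabel mono (2 ∷ 2 ∷ 1 ∷ 1 ∷ [])))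
                                     (schur-relabel mono (2 ∷ 2 ∷ 2 ∷ []))

γ₀-homogeneous : All (λ cw → length (proj₂ cw) ≡ 6) γ₀
γ₀-homogeneous = from-yes (all? (λ cw → length (proj₂ cw) ℕP.≟ 6) γ₀)

F-γ₀-expansion : F γ₀ ≈ₛ expansion
F-γ₀-expansion i ↗i _ with length i ℕP.≟ 6
... | no  |i|≢6 = trans (F-wrong-length 6 γ₀ i γ₀-homogeneous |i|≢6) (sym (begin
    expansion i
  ≡⟨ cong₂ ℤ._-_ (cong₂ ℤ._+_ (schur-wrong-size (3 ∷ 2 ∷ 1 ∷ []) i |i|≢6) (schur-wrong-size (2 ∷ 2 ∷ 1 ∷ 1 ∷ []) i |i|≢6))
                 (schur-wrong-size (2 ∷ 2 ∷ 2 ∷ []) i |i|≢6) ⟩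
    + 0
  ∎)) where open ≡-Reasoning
... | yes |i|≡6 = begin
    F γ₀ i
  ≡⟨ cong (F γ₀) labelling ⟨
    F γ₀ (map label standard)
  ≡⟨ F-relabel monotone γ₀ ⟩
    F γ₀ standard
  ≡⟨ All.lookup F-γ₀-patterns (subst (λ n → standard ∈ patterns n) |i|≡6 standard∈) ⟩
    expansion standard
  ≡⟨ expansion-relabel monotone ⟨
    expansion (map label standard)
  ≡⟨ cong expansion labelling ⟩
    expansion i
  ∎ where
    open ≡-Reasoning
    open Standardization (standardize i ↗i)

compositions : ℕ → List (List ℕ)
compositions zero    = [] ∷ []
compositions (suc n) = map (1 ∷_) (compositions n) ++ map enlarge (compositions n)
  where
    enlarge : List ℕ → List ℕ
    enlarge []      = []
    enlarge (a ∷ μ) = suc a ∷ μ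

∈-compositions : ∀ μ → All (1 ℕ.≤_) μ → μ ∈ compositions (sum μ)
∈-compositions []              []       = here refl
∈-compositions (suc a ∷ μ) (_ ∷ μ⁺) = go a
  where
    go : ∀ a → (suc a ∷ μ) ∈ compositions (suc a + sum μ)
    go zero    = ∈-++⁺ˡ (∈-map⁺ (1 ∷_) (∈-compositions μ μ⁺))
    go (suc a) = ∈-++⁺ʳ _ (∈-map⁺ _ (go a))

x³²¹ x²²² x³³ x⁴² x⁴¹¹ : List ℕ
x³²¹ = 1 ∷ 1 ∷ 1 ∷ 2 ∷ 2 ∷ 3 ∷ []
x²²² = 1 ∷ 1 ∷ 2 ∷ 2 ∷ 3 ∷ 3 ∷ []
x³³  = 1 ∷ 1 ∷ 1 ∷ 2 ∷ 2 ∷ 2 ∷ []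
x⁴²  = 1 ∷ 1 ∷ 1 ∷ 1 ∷ 2 ∷ 2 ∷ []
x⁴¹¹ = 1 ∷ 1 ∷ 1 ∷ 1 ∷ 2 ∷ 3 ∷ []

separator : Series → ℤ
separator f = + 2 ℤ.* f x³²¹ ℤ.- f x²²² ℤ.- + 10 ℤ.* (f x³³ ℤ.+ f x⁴² ℤ.+ f x⁴¹¹)

tests : List (List ℕ)
tests = x³²¹ ∷ x²²² ∷ x³³ ∷ x⁴² ∷ x⁴¹¹ ∷ []

separator-cong : ∀ {f g} → All (λ i → f i ≡ g i) tests → separator f ≡ separator g
separator-cong (e₁ ∷ e₂ ∷ e₃ ∷ e₄ ∷ e₅ ∷ []) rewrite e₁ | e₂ | e₃ | e₄ | e₅ = refl

tests-size : All (λ i → length i ≡ 6) tests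
tests-size = refl ∷ refl ∷ refl ∷ refl ∷ refl ∷ []

tests-monomials : All (λ i → Linked ℕ._≤_ i × All (1 ℕ.≤_) i) tests
tests-monomials = from-yes (all? (λ i → linked? ℕP._≤?_ i ×-dec all? (1 ℕP.≤?_) i) tests)

separator-schur-size6 : All (λ μ → separator (schur μ) ℤ.≤ + 0) (compositions 6)
separator-schur-size6 = from-yes (all? (λ μ → separator (schur μ) ℤP.≤? + 0) (compositions 6))

separator-schur : ∀ μ → All (1 ℕ.≤_) μ → separator (schur μ) ℤ.≤ + 0
separator-schur μ μ⁺ with sum μ ℕP.≟ 6
... | yes |μ|≡6 = All.lookup separator-schur-size6 (subst (λ n → μ ∈ compositions n) |μ|≡6 (∈-compositions μ μ⁺))
... | no  ≢6   = ℤP.≤-reflexive (separator-cong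
                   (All.map (λ {i} |i|≡6 → schur-wrong-size μ i (λ |i|≡|μ| → ≢6 (trans (sym |i|≡|μ|) |i|≡6))) tests-size))

separator-sum : ∀ L → separator (λ i → sumℤ (map (λ μ → schur μ i) L)) ≡ sumℤ (map (separator ∘ schur) L)
separator-sum []      = refl
separator-sum (μ ∷ L) rewrite sym (separator-sum L) =
  solve 10 (λ a b c d e a′ b′ c′ d′ e′ →
    con (+ 2) :* (a :+ a′) :- (b :+ b′) :- con (+ 10) :* ((c :+ c′) :+ (d :+ d′) :+ (e :+ e′))
    := (con (+ 2) :* a :- b :- con (+ 10) :* (c :+ d :+ e)) :+ (con (+ 2) :* a′ :- b′ :- con (+ 10) :* (c′ :+ d′ :+ e′)))
    refl (schur μ x³²¹) (schur μ x²²²) (schur μ x³³) (schur μ x⁴²) (schur μ x⁴¹¹)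
         (total x³²¹) (total x²²²) (total x³³) (total x⁴²) (total x⁴¹¹)
  where
    open +-*-Solver
    total : List ℕ → ℤ
    total i = sumℤ (map (λ μ → schur μ i) L)

sumℤ-nonpos : ∀ xs → All (ℤ._≤ + 0) xs → sumℤ xs ℤ.≤ + 0
sumℤ-nonpos []       []           = ℤP.≤-refl
sumℤ-nonpos (x ∷ xs) (x≤0 ∷ xs≤0) = ℤP.+-mono-≤ x≤0 (sumℤ-nonpos xs xs≤0)

¬SchurPositive-F-γ₀ : ¬ SchurPositive (F γ₀)
¬SchurPositive-F-γ₀ (L , partitions , F≈) = ℤP.<⇒≱ (ℤ.+<+ (s≤s z≤n)) (begin
    + 1
  ≡⟨⟩
    separator (F γ₀)
  ≡⟨ separator-cong (All.map (λ (↗ , ⁺) → F≈ _ ↗ ⁺) tests-monomials) ⟩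
    separator (λ i → sumℤ (map (λ μ → schur μ i) L))
  ≡⟨ separator-sum L ⟩
    sumℤ (map (separator ∘ schur) L)
  ≤⟨ sumℤ-nonpos _ (AllP.map⁺ (All.map (λ μ-partition → separator-schur _ (proj₂ μ-partition)) partitions)) ⟩
    + 0
  ∎)
  where open ℤP.≤-Reasoning

InAlphabet-mono : ∀ {M N} p → M ≤ N → InAlphabet M p → InAlphabet N p
InAlphabet-mono p M≤N = All.map (All.map (λ (1≤x , x≤M) → 1≤x , ℕP.≤-trans x≤M M≤N))

γ₀-nonneg : NonNeg γ₀
γ₀-nonneg = from-yes (all? (λ cw → + 0 ℤP.≤? proj₁ cw) γ₀)

222-partition : IsPartition (2 ∷ 2 ∷ 2 ∷ [])
222-partition = (s≤s (s≤s z≤n) ∷ s≤s (s≤s z≤n) ∷ [-]) , (s≤s z≤n ∷ s≤s z≤n ∷ s≤s z≤n ∷ [])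

corollary3p9 : (N : ℕ) → 6 ≤ N →
    ( Perp N (GenS N) γ₀
    × (F γ₀ ≈ₛ ((schur (3 ∷ 2 ∷ 1 ∷ []) +ₛ schur (2 ∷ 2 ∷ 1 ∷ 1 ∷ [])) -ₛ schur (2 ∷ 2 ∷ 2 ∷ [])))
    × ¬ SchurPositive (F γ₀) )
    × ( ¬ QMonPos N (GenS N) (𝔍 N (2 ∷ 2 ∷ 2 ∷ []))
    × ¬ QMonPos N (GenC N) (𝔍 N (2 ∷ 2 ∷ 2 ∷ [])) )
    × ( (Σ Poly λ γ → NonNeg γ × InAlphabet N γ × Perp N (GenS N) γ × ¬ SchurPositive (F γ))
    × (Σ (List ℕ) λ μ → IsPartition μ × ¬ QMonPos N (GenS N) (𝔍 N μ))
    × (Σ Poly λ γ → NonNeg γ × InAlphabet N γ × Perp N (GenC N) γ × ¬ SchurPositive (F γ))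
    × (Σ (List ℕ) λ μ → IsPartition μ × ¬ QMonPos N (GenC N) (𝔍 N μ)) )
corollary3p9 N 6≤N =
  (γ₀-perp-S N , F-γ₀-expansion , ¬SchurPositive-F-γ₀) ,
  (¬QMonPos-S , ¬QMonPos-C) ,
  ( (γ₀ , γ₀-nonneg , γ₀-alphabetN , γ₀-perp-S N , ¬SchurPositive-F-γ₀)
  , (2 ∷ 2 ∷ 2 ∷ [] , 222-partition , ¬QMonPos-S)
  , (γ₀ , γ₀-nonneg , γ₀-alphabetN , γ₀-perp-C N , ¬SchurPositive-F-γ₀)
  , (2 ∷ 2 ∷ 2 ∷ [] , 222-partition , ¬QMonPos-C) )
  where
    γ₀-alphabetN = InAlphabet-mono γ₀ 6≤N γ₀-alphabet
    𝔍₂₂₂<0 = subst (ℤ._< + 0) (sym (pair-𝔍₂₂₂-γ₀ N 6≤N)) ℤ.-<+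
    ¬QMonPos-S = ¬QMonPos-from-perp N (GenS N) γ₀ (𝔍 N (2 ∷ 2 ∷ 2 ∷ [])) γ₀-nonneg (γ₀-perp-S N) 𝔍₂₂₂<0
    ¬QMonPos-C = ¬QMonPos-from-perp N (GenC N) γ₀ (𝔍 N (2 ∷ 2 ∷ 2 ∷ [])) γ₀-nonneg (γ₀-perp-C N) 𝔍₂₂₂<0
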